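{- Let $m\ge1$. The polynomials $\mathrm{cwe}(C(m))$, where $C$ ranges over equivalence classes of binary self-orthogonal linear codes (of any length $N$) containing the all-ones vector $\mathbf 1$ and of dimension at most $m+1$, form a basis of the space of parabolic invariants, i.e. of polynomials in $\mathbb{R}[x_v : v\in\mathbb{F}_2^{\,m}]$ invariant under the parabolic subgroup $P$.
   Context: Index the standard basis of $\mathbb{R}^{2^m}$ by $v\in\mathbb{F}_2^{\,m}$ and let $g\in GL(2^m,\mathbb{R})$ act on $\mathbb{R}[x_v:v\in\mathbb{F}_2^{\,m}]$ by linear substitution $(g\cdot p)(x)=p(g^{ -1}x)$. The parabolic subgroup $P\le O(2^m,\mathbb{R})$ is the group generated by (1) the diagonal matrices $\mathrm{diag}((-1)^{q(v)+a})_{v}$ for all quadratic forms $q(v)=\sum_{i\le j}c_{ij}v_iv_j$ ($c_{ij}\in\mathbb{F}_2$) on $\mathbb{F}_2^{\,m}$ and $a\in\{0,1\}$, and (2) the permutation matrices $b_v\mapsto b_{g(v)}$ for $g\in AGL(m,2)$. Fix an $\mathbb{F}_2$-basis $a_1,\dots,a_m$ of $\mathbb{F}_{2^m}$ and identify $f=\sum\varepsilon_ia_i$ with $(\varepsilon_i)\in\mathbb{F}_2^{\,m}$ so that $x_f=x_v$. For a binary linear code $C\subseteq\mathbb{F}_2^N$, $C(m)=C\otimes_{\mathbb{F}_2}\mathbb{F}_{2^m}$ and $\mathrm{cwe}(C(m))=\sum_{c\in C(m)}\prod_fx_f^{a_f(c)}$, $a_f(c)$ the number of coordinates equal to $f$.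 Self-orthogonal means $C\subseteq C^\perp$ (standard dot product); two codes are equivalent if one is obtained from the other by a permutation of coordinates.
   Formalization: The polynomials and the coefficients of linear combinations are rational instead of real; that equivalent codes have the same complete weight enumerator is taken as evident and not part of the statement. -}

module Defs where

open import Data.Bool using (Bool; true; false; _xor_; _∧_; if_then_else_)
open import Data.Nat as ℕ using (ℕ; zero; suc; _≤_; _≡ᵇ_)
open import Data.Fin as F using (Fin)
open import Data.Vec as V using (Vec; []; _∷_; lookup; tabulate; zipWith; replicate)
open import Data.List as L using (List; []; _∷_; allFin; concatMap; filterᵇ; length)
open import Data.Rational using (ℚ; 0ℚ; 1ℚ; -_; _+_; _*_)
open import Data.Product using (Σ; _×_; _,_; proj₁; proj₂)
open import Relation.Binary.PropositionalEquality using (_≡_)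
open import Relation.Nullary.Decidable using (⌊_⌋)
open import Function.Bundles using (_↔_; Inverse)

-- F₂ = Bool (false = 0, true = 1, xor = +, ∧ = ·); F₂ⁿ = Vec Bool n

infixl 6 _⊕_
_⊕_ : ∀ {n} → Vec Bool n → Vec Bool n → Vec Bool n
_⊕_ = zipWith _xor_

oddᵇ : ℕ → Bool
oddᵇ zero    = false
oddᵇ (suc n) = if oddᵇ n then false else true

xorSum : List Bool → Bool
xorSum = L.foldr _xor_ false

dot : ∀ {n} → Vec Bool n → Vec Bool n → Bool
dot x y = V.foldr _ _xor_ false (zipWith _∧_ x y)

allVecs : (n : ℕ) → List (Vec Bool n)
allVecs zero    = [] ∷ []
allVecs (suc n) = L.map (false ∷_) (allVecs n) L.++ L.map (true ∷_) (allVecs n)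

eqV : ∀ {n} → Vec Bool n → Vec Bool n → Bool
eqV []       []       = true
eqV (a ∷ x) (b ∷ y) = (if a then b else (if b then false else true)) ∧ eqV x y

-- Polynomials in ℚ[x_v : v ∈ F₂^m]  (ℚ instead of ℝ)

-- a monomial ∏_v x_v^{e v}
Monomial : ℕ → Set
Monomial m = Vec Bool m → ℕ

eqMon : ∀ {m} → Monomial m → Monomial m → Bool
eqMon {m} e e' = L.foldr _∧_ true (L.map (λ v → e v ≡ᵇ e' v) (allVecs m))

-- a polynomial as a finite formal sum of terms c·x^e
Poly : ℕ → Set
Poly m = List (ℚ × Monomial m)

coeff : ∀ {m} → Poly m → Monomial m → ℚ
coeff []              e = 0ℚ
coeff ((c , e') ∷ p) e = (if eqMon e' e then c else 0ℚ) + coeff p e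

infix 4 _≈P_
_≈P_ : ∀ {m} → Poly m → Poly m → Set
p ≈P q = ∀ e → coeff p e ≡ coeff q e

scale : ∀ {m} → ℚ → Poly m → Poly m
scale λ' = L.map (λ t → (λ' * proj₁ t , proj₂ t))

-- The parabolic group P, given by its generators acting by
-- (g·p)(x) = p(g⁻¹ x).

Mat : ℕ → Set
Mat m = Fin m → Fin m → Bool

matVec : ∀ {m} → Mat m → Vec Bool m → Vec Bool m
matVec {m} A v = tabulate (λ i → xorSum (L.map (λ j → A i j ∧ lookup v j) (allFin m)))

quadForm : ∀ {m} → Mat m → Vec Bool m → Bool
quadForm {m} c v =
  xorSum (concatMap (λ i → L.map (λ j → ⌊ i F.≤? j ⌋ ∧ c i j ∧ lookup v i ∧ lookup v j)
                                (allFin m))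
                    (allFin m))

data Gen (m : ℕ) : Set where
  -- diag((-1)^{q(v)+a})_v
  sign   : (c : Mat m) (a : Bool) → Gen m
  -- the permutation b_v ↦ b_{g v}, g v = A v + b, g ∈ AGL(m,2); B = A⁻¹
  affine : (A B : Mat m) (b : Vec Bool m)
           → (∀ v → matVec A (matVec B v) ≡ v)
           → (∀ v → matVec B (matVec A v) ≡ v)
           → Gen m

actTerm : ∀ {m} → Gen m → ℚ × Monomial m → ℚ × Monomial m
actTerm {m} (sign c a) (k , e) =
  -- x_v ↦ (-1)^{q(v)+a} x_v, so x^e ↦ (-1)^{Σ_v (q(v)+a) e_v} x^e
  (if xorSum (L.map (λ v → (quadForm c v xor a) ∧ oddᵇ (e v)) (allVecs m))
     then - k else k)
  , e
actTerm (affine A B b _ _) (k , e) =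
  -- x_v ↦ x_{g v}, so the exponent of x_w becomes e(g⁻¹ w) = e(B(w + b))
  k , (λ w → e (matVec B (w ⊕ b)))

actGen : ∀ {m} → Gen m → Poly m → Poly m
actGen g = L.map (actTerm g)

-- elements of P as words in the generators
act : ∀ {m} → List (Gen m) → Poly m → Poly m
act []      p = p
act (g ∷ w) p = actGen g (act w p)

Invariant : (m : ℕ) → Poly m → Set
Invariant m p = ∀ (w : List (Gen m)) → act w p ≈P p

record LinearCode (N : ℕ) : Set where
  field
    mem      : Vec Bool N → Bool
    mem-zero : mem (replicate N false) ≡ true
    mem-add  : ∀ x y → mem x ≡ true → mem y ≡ true → mem (x ⊕ y) ≡ true
open LinearCode public

infix 4 _∈C_ _∈⊥_
_∈C_ : ∀ {N} → Vec Bool N → LinearCode N → Set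
x ∈C C = mem C x ≡ true

_∈⊥_ : ∀ {N} → Vec Bool N → LinearCode N → Set
x ∈⊥ C = ∀ y → y ∈C C → dot x y ≡ false

SelfOrthogonal : ∀ {N} → LinearCode N → Set
SelfOrthogonal C = ∀ x → x ∈C C → x ∈⊥ C

ContainsOnes : ∀ {N} → LinearCode N → Set
ContainsOnes {N} C = replicate N true ∈C C

combo : ∀ {N k} → Vec Bool k → Vec (Vec Bool N) k → Vec Bool N
combo {N} []        []       = replicate N false
combo     (l ∷ ls) (g ∷ gs) = (if l then g else replicate _ false) ⊕ combo ls gs

DimAtMost : ∀ {N} → ℕ → LinearCode N → Set
DimAtMost {N} d C =
  Σ ℕ λ k → k ≤ d × Σ (Vec (Vec Bool N) k) λ G →
    (∀ x → x ∈C C → Σ (Vec Bool k) λ ls → combo ls G ≡ x)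
    × (∀ ls → combo ls G ∈C C)

-- equivalence: C' is obtained from C by a permutation σ of coordinates,
-- (σ x)_{σ i} = x_i
permuteV : ∀ {N N'} → Fin N ↔ Fin N' → Vec Bool N → Vec Bool N'
permuteV σ x = tabulate (λ j → lookup x (Inverse.from σ j))

Equivalent : ∀ {N N'} → LinearCode N → LinearCode N' → Set
Equivalent {N} {N'} C C' =
  Σ (Fin N ↔ Fin N') λ σ → ∀ x → mem C' (permuteV σ x) ≡ mem C x

-- cwe(C(m)).  With the fixed basis a₁,…,a_m of F_{2^m}, an element of
-- C(m) = C ⊗ F_{2^m} is Σ_i c_i ⊗ a_i with (c₁,…,c_m) ∈ C^m uniquely, its
-- j-th coordinate is Σ_i c_{i j} a_i, identified with (c_{1j},…,c_{mj}) ∈ F₂^m.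

codewords : ∀ {N} → LinearCode N → List (Vec Bool N)
codewords {N} C = filterᵇ (mem C) (allVecs N)

tuples : ∀ {A : Set} (m : ℕ) → List A → List (Vec A m)
tuples zero    xs = [] ∷ []
tuples (suc m) xs = concatMap (λ x → L.map (x ∷_) (tuples m xs)) xs

-- the monomial ∏_f x_f^{a_f(c)} of the codeword c = Σ c_i ⊗ a_i
cweMonomial : ∀ {m N} → Vec (Vec Bool N) m → Monomial m
cweMonomial {m} {N} t v =
  length (filterᵇ (λ j → eqV (V.map (λ c → lookup c j) t) v) (allFin N))

cwe : ∀ (m : ℕ) {N} → LinearCode N → Poly m
cwe m C = L.map (λ t → (1ℚ , cweMonomial t)) (tuples m (codewords C))

Admissible : (m : ℕ) → ∀ {N} → LinearCode N → Set
Admissible m C = SelfOrthogonal C × ContainsOnes C × DimAtMost (suc m) C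

AdmCode : ℕ → Set
AdmCode m = Σ ℕ λ N → Σ (LinearCode N) (Admissible m)

codeOf : ∀ {m} (A : AdmCode m) → LinearCode (proj₁ A)
codeOf A = proj₁ (proj₂ A)

EquivAdm : ∀ {m} → AdmCode m → AdmCode m → Set
EquivAdm A B = Equivalent (codeOf A) (codeOf B)

linComb : (m : ℕ) → List (ℚ × AdmCode m) → Poly m
linComb m = concatMap (λ t → scale (proj₁ t) (cwe m (codeOf (proj₂ t))))

{-# OPTIONS --safe #-}

-- Write a monomial of degree N as the multiset of columns of an m-tuple t of
-- words of length N, and let D(t) be the code spanned by t and 𝟏.  The signs
-- fix the monomial of t exactly when D(t) is self-orthogonal, and two tuples
-- with the same D(t) lie in one affine orbit.  Hence the invariants have as
-- basis the sums G(D) over tuples with D(t) = D, for D up to equivalence, and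
-- cwe(C(m)) = Σ G(D) over the subcodes D ∋ 𝟏 of C, which is triangular with
-- respect to the number of codewords.

module Submission where

open import Defs
open import Data.Bool using (Bool; true; false; not; _xor_; _∧_; if_then_else_; T)
open import Data.Bool.Properties as 𝔹
  using (xor-assoc; xor-comm; xor-identityʳ; xor-same; ∧-distribˡ-xor; ∧-zeroʳ; ∧-identityʳ; ∧-comm)
open import Data.Fin as F using (Fin; zero; suc; punchIn)
import Data.Fin.Permutation as Perm
open Perm using (insert; insert-punchIn)
import Data.Fin.Properties as FP
open import Data.List as L using (List; []; _∷_; concatMap; filterᵇ; length; _++_)
open import Data.List.Membership.Propositional using (_∈_; find)
import Data.List.Membership.Propositional.Properties as ∈P
import Data.List.Properties as LP
open import Data.List.Relation.Binary.Permutation.Propositional as ↭ using (_↭_; ↭-trans; ↭-refl; prep)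
import Data.List.Relation.Binary.Permutation.Propositional.Properties as ↭P
open import Data.List.Relation.Unary.All as All using (All; []; _∷_)
open import Data.List.Relation.Unary.AllPairs using (AllPairs; []; _∷_)
open import Data.List.Relation.Unary.Any as Any using (Any; here; there)
import Data.List.Relation.Unary.Any.Properties as AnyP
open import Data.List.Relation.Unary.Unique.Propositional using (Unique)
import Data.List.Relation.Unary.Unique.Propositional.Properties as Uniq
open import Data.Nat using (ℕ; zero; suc; _+_; _⊔_; _≤_; _<_; _≡ᵇ_; z≤n; s≤s; s≤s⁻¹)
open import Data.Nat.ListAction using (sum)
open import Data.Nat.ListAction.Properties using (sum-++)
import Data.Nat.Properties as ℕP
open import Data.Product using (Σ; ∃; _×_; _,_; proj₁; proj₂)
open import Data.Rational as ℚ using (ℚ; 0ℚ; 1ℚ)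
import Data.Rational.Properties as ℚP
open import Data.Sum using (_⊎_; inj₁; inj₂)
open import Data.Vec as V using (Vec; []; _∷_; lookup; tabulate; zipWith; replicate)
open import Data.Vec.Properties as VP
  using (zipWith-assoc; zipWith-comm; zipWith-identityˡ; zipWith-identityʳ; lookup-zipWith;
         lookup-map; lookup-replicate; lookup∘tabulate; tabulate∘lookup; tabulate-cong)
open import Function using (_∘_; id)
open import Function.Bundles using (_↔_; Inverse)
open import Relation.Binary.Definitions using (tri<; tri≈; tri>)
open import Relation.Binary.PropositionalEquality
open import Relation.Nullary using (¬_; yes; no; Dec; contradiction)
open import Relation.Nullary.Decidable using (⌊_⌋; fromWitness; toWitness; _⊎-dec_)
open import Relation.Unary using (_⊆_)
open ≡-Reasoning

-- Linear algebra over F₂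

-- Everything rests on a dictionary between columns and rows. A quadratic form summed over the
-- columns of t is a combination of dot products of rows, and the constant contributes the parity of
-- N; hence the signs test self-orthogonality. An affine map of the columns recombines the rows and
-- adds `𝟏` to some of them; hence it keeps D(t). The bound m + 1 on the dimension counts the m rows
-- and `𝟏`. The delicate point is that equal D(t) means one affine orbit: rows may be dependent and
-- `𝟏` may lie in their span, so there is no basis to change. Tuples are joined instead by
-- elementary row moves that keep the number of rows and allow `𝟏` to be added at will. The sums
-- G(D) are never formed. A coefficient of cwe(C(m)) counts tuples, so nothing cancels, and its
-- value at a generating tuple serves as a pivot: elimination by decreasing size gives spanning, and
-- the same pivots give independence. Size is the number of words, because a coordinate permutation
-- carrying C into C' is onto as soon as the counts agree.

𝟎 𝟏 : ∀ {n} → Vec Bool n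
𝟎 = replicate _ false
𝟏 = replicate _ true

⊕-assoc : ∀ {n} (x y z : Vec Bool n) → (x ⊕ y) ⊕ z ≡ x ⊕ (y ⊕ z)
⊕-assoc = zipWith-assoc xor-assoc

⊕-comm : ∀ {n} (x y : Vec Bool n) → x ⊕ y ≡ y ⊕ x
⊕-comm = zipWith-comm xor-comm

⊕-identityˡ : ∀ {n} (x : Vec Bool n) → 𝟎 ⊕ x ≡ x
⊕-identityˡ = zipWith-identityˡ (λ _ → refl)

⊕-identityʳ : ∀ {n} (x : Vec Bool n) → x ⊕ 𝟎 ≡ x
⊕-identityʳ = zipWith-identityʳ xor-identityʳ

⊕-self : ∀ {n} (x : Vec Bool n) → x ⊕ x ≡ 𝟎
⊕-self []      = refl
⊕-self (a ∷ x) = cong₂ _∷_ (xor-same a) (⊕-self x)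

⊕-cancelʳ : ∀ {n} (x y : Vec Bool n) → (x ⊕ y) ⊕ y ≡ x
⊕-cancelʳ x y = trans (⊕-assoc x y y) (trans (cong (x ⊕_) (⊕-self y)) (⊕-identityʳ x))

⊕-swapʳ : ∀ {n} (x y z : Vec Bool n) → (x ⊕ y) ⊕ z ≡ (x ⊕ z) ⊕ y
⊕-swapʳ x y z = trans (⊕-assoc x y z) (trans (cong (x ⊕_) (⊕-comm y z)) (sym (⊕-assoc x z y)))

⊕-cancel-mid : ∀ {n} (x y z : Vec Bool n) → (x ⊕ z) ⊕ (y ⊕ z) ≡ x ⊕ y
⊕-cancel-mid x y z = begin
  (x ⊕ z) ⊕ (y ⊕ z) ≡⟨ sym (⊕-assoc (x ⊕ z) y z) ⟩
  ((x ⊕ z) ⊕ y) ⊕ z ≡⟨ cong (_⊕ z) (⊕-swapʳ x z y) ⟩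
  ((x ⊕ y) ⊕ z) ⊕ z ≡⟨ ⊕-cancelʳ (x ⊕ y) z ⟩
  x ⊕ y             ∎

lookup-ext : ∀ {A : Set} {n} {x y : Vec A n} → (∀ i → lookup x i ≡ lookup y i) → x ≡ y
lookup-ext {x = x} {y} h = trans (sym (tabulate∘lookup x)) (trans (tabulate-cong h) (tabulate∘lookup y))

eqV⇒≡ : ∀ {n} (x y : Vec Bool n) → eqV x y ≡ true → x ≡ y
eqV⇒≡ []          []          _ = refl
eqV⇒≡ (true ∷ x)  (true ∷ y)  h = cong (true ∷_) (eqV⇒≡ x y h)
eqV⇒≡ (false ∷ x) (false ∷ y) h = cong (false ∷_) (eqV⇒≡ x y h)

eqV-refl : ∀ {n} (x : Vec Bool n) → eqV x x ≡ true
eqV-refl []          = refl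
eqV-refl (true ∷ x)  = eqV-refl x
eqV-refl (false ∷ x) = eqV-refl x

true-ext : ∀ {a b} → (a ≡ true → b ≡ true) → (b ≡ true → a ≡ true) → a ≡ b
true-ext {false} {false} _ _ = refl
true-ext {true}  {true}  _ _ = refl
true-ext {true}  {false} f _ = sym (f refl)
true-ext {false} {true}  _ g = g refl

xor-interchange : ∀ a b c d → (a xor b) xor (c xor d) ≡ (a xor c) xor (b xor d)
xor-interchange a b c d = begin
  (a xor b) xor (c xor d) ≡⟨ xor-assoc a b (c xor d) ⟩
  a xor (b xor (c xor d)) ≡⟨ cong (a xor_) (sym (xor-assoc b c d)) ⟩
  a xor ((b xor c) xor d) ≡⟨ cong (λ u → a xor (u xor d)) (xor-comm b c) ⟩
  a xor ((c xor b) xor d) ≡⟨ cong (a xor_) (xor-assoc c b d) ⟩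
  a xor (c xor (b xor d)) ≡⟨ sym (xor-assoc a c (b xor d)) ⟩
  (a xor c) xor (b xor d) ∎

-- Opaque, so that unification treats ⨁ as injective.
opaque
  ⨁ : ∀ {n} → (Fin n → Bool) → Bool
  ⨁ {zero}  f = false
  ⨁ {suc n} f = f zero xor ⨁ (f ∘ suc)

  ⨁-cong : ∀ {n} {f g : Fin n → Bool} → (∀ i → f i ≡ g i) → ⨁ f ≡ ⨁ g
  ⨁-cong {zero}  h = refl
  ⨁-cong {suc n} h = cong₂ _xor_ (h zero) (⨁-cong (h ∘ suc))

  ⨁-false : ∀ {n} {f : Fin n → Bool} → (∀ i → f i ≡ false) → ⨁ f ≡ false
  ⨁-false {zero}  h = refl
  ⨁-false {suc n} h = cong₂ _xor_ (h zero) (⨁-false (h ∘ suc))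

  ⨁-xor : ∀ {n} (f g : Fin n → Bool) → ⨁ (λ i → f i xor g i) ≡ ⨁ f xor ⨁ g
  ⨁-xor {zero}  f g = refl
  ⨁-xor {suc n} f g = trans (cong ((f zero xor g zero) xor_) (⨁-xor (f ∘ suc) (g ∘ suc)))
    (xor-interchange (f zero) (g zero) _ _)

  ⨁-∧ : ∀ {n} a (f : Fin n → Bool) → ⨁ (λ i → a ∧ f i) ≡ a ∧ ⨁ f
  ⨁-∧ {zero}  a f = sym (∧-zeroʳ a)
  ⨁-∧ {suc n} a f = trans (cong ((a ∧ f zero) xor_) (⨁-∧ a (f ∘ suc)))
    (sym (∧-distribˡ-xor a (f zero) _))

  ⨁-swap : ∀ {n k} (f : Fin n → Fin k → Bool) → ⨁ (λ i → ⨁ (f i)) ≡ ⨁ (λ j → ⨁ (λ i → f i j))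
  ⨁-swap {zero} {k} f = sym (⨁-false {k} (λ _ → refl))
  ⨁-swap {suc n} f = trans (cong (⨁ (f zero) xor_) (⨁-swap (f ∘ suc)))
    (sym (⨁-xor (f zero) _))

  ⨁-delta : ∀ {n} (i₀ : Fin n) (f : Fin n → Bool) → (∀ i → i ≢ i₀ → f i ≡ false) → ⨁ f ≡ f i₀
  ⨁-delta zero     f h = trans (cong (f zero xor_) (⨁-false (λ i → h (suc i) λ ()))) (xor-identityʳ _)
  ⨁-delta (suc i₀) f h = cong₂ _xor_ (h zero λ ())
    (⨁-delta i₀ (f ∘ suc) (λ i i≢ → h (suc i) (λ { refl → i≢ refl })))

  xorSum-tabulate : ∀ {A : Set} {n} (f : A → Bool) (g : Fin n → A) → xorSum (L.map f (L.tabulate g)) ≡ ⨁ (f ∘ g)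
  xorSum-tabulate {n = zero}  f g = refl
  xorSum-tabulate {n = suc n} f g = cong (f (g zero) xor_) (xorSum-tabulate f (g ∘ suc))

xorSum-++ : ∀ xs ys → xorSum (xs ++ ys) ≡ xorSum xs xor xorSum ys
xorSum-++ []       ys = refl
xorSum-++ (x ∷ xs) ys = trans (cong (x xor_) (xorSum-++ xs ys)) (sym (xor-assoc x _ _))

opaque
  unfolding ⨁
  xorSum-concatMap : ∀ {A : Set} {n} (f : A → List Bool) (g : Fin n → A) →
    xorSum (concatMap f (L.tabulate g)) ≡ ⨁ (xorSum ∘ f ∘ g)
  xorSum-concatMap {n = zero}  f g = refl
  xorSum-concatMap {n = suc n} f g = trans (xorSum-++ (f (g zero)) _) (cong (xorSum (f (g zero)) xor_) (xorSum-concatMap f (g ∘ suc)))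

xorSum-cong : ∀ {A : Set} {f g : A → Bool} → (∀ x → f x ≡ g x) → ∀ xs → xorSum (L.map f xs) ≡ xorSum (L.map g xs)
xorSum-cong h []       = refl
xorSum-cong h (x ∷ xs) = cong₂ _xor_ (h x) (xorSum-cong h xs)

xorSum-false : ∀ {A : Set} {f : A → Bool} → (∀ x → f x ≡ false) → ∀ xs → xorSum (L.map f xs) ≡ false
xorSum-false h []       = refl
xorSum-false h (x ∷ xs) = cong₂ _xor_ (h x) (xorSum-false h xs)

xorSum-⨁ : ∀ {A : Set} {n} (f : A → Fin n → Bool) xs →
  xorSum (L.map (λ x → ⨁ (f x)) xs) ≡ ⨁ (λ j → xorSum (L.map (λ x → f x j) xs))
xorSum-⨁ f []       = sym (⨁-false (λ _ → refl))
xorSum-⨁ f (x ∷ xs) = trans (cong (⨁ (f x) xor_) (xorSum-⨁ f xs)) (sym (⨁-xor (f x) _))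

xorSum-allVecs-∷ : ∀ {m} (f : Vec Bool (suc m) → Bool) →
  xorSum (L.map f (allVecs (suc m))) ≡
  xorSum (L.map (f ∘ (false ∷_)) (allVecs m)) xor xorSum (L.map (f ∘ (true ∷_)) (allVecs m))
xorSum-allVecs-∷ {m} f = begin
  xorSum (L.map f (L.map (false ∷_) X ++ L.map (true ∷_) X))
    ≡⟨ cong xorSum (LP.map-++ f (L.map (false ∷_) X) _) ⟩
  xorSum (L.map f (L.map (false ∷_) X) ++ L.map f (L.map (true ∷_) X))
    ≡⟨ xorSum-++ (L.map f (L.map (false ∷_) X)) _ ⟩
  xorSum (L.map f (L.map (false ∷_) X)) xor xorSum (L.map f (L.map (true ∷_) X))
    ≡⟨ cong₂ _xor_ (cong xorSum (sym (LP.map-∘ X))) (cong xorSum (sym (LP.map-∘ X))) ⟩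
  _ ∎
  where
    X = allVecs m

xorSum-delta : ∀ {m} (h : Vec Bool m → Bool) (x : Vec Bool m) →
  xorSum (L.map (λ v → h v ∧ eqV x v) (allVecs m)) ≡ h x
xorSum-delta h []          = trans (xor-identityʳ _) (∧-identityʳ _)
xorSum-delta h (false ∷ x) = trans (xorSum-allVecs-∷ (λ v → h v ∧ eqV (false ∷ x) v)) (trans
  (cong₂ _xor_ (xorSum-delta (h ∘ (false ∷_)) x) (xorSum-false (λ v → ∧-zeroʳ (h (true ∷ v))) (allVecs _)))
  (xor-identityʳ _))
xorSum-delta h (true ∷ x)  = trans (xorSum-allVecs-∷ (λ v → h v ∧ eqV (true ∷ x) v))
  (cong₂ _xor_ (xorSum-false (λ v → ∧-zeroʳ (h (false ∷ v))) (allVecs _)) (xorSum-delta (h ∘ (true ∷_)) x))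

opaque
  unfolding ⨁
  dot-⨁ : ∀ {n} (x y : Vec Bool n) → dot x y ≡ ⨁ (λ j → lookup x j ∧ lookup y j)
  dot-⨁ []      []      = refl
  dot-⨁ (a ∷ x) (b ∷ y) = cong ((a ∧ b) xor_) (dot-⨁ x y)

dot-comm : ∀ {n} (x y : Vec Bool n) → dot x y ≡ dot y x
dot-comm []      []      = refl
dot-comm (a ∷ x) (b ∷ y) = cong₂ _xor_ (∧-comm a b) (dot-comm x y)

dot-⊕ʳ : ∀ {n} (x y z : Vec Bool n) → dot x (y ⊕ z) ≡ dot x y xor dot x z
dot-⊕ʳ []      []      []      = refl
dot-⊕ʳ (a ∷ x) (b ∷ y) (c ∷ z) = trans
  (cong₂ _xor_ (∧-distribˡ-xor a b c) (dot-⊕ʳ x y z))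
  (xor-interchange (a ∧ b) (a ∧ c) _ _)

dot-𝟎ʳ : ∀ {n} (x : Vec Bool n) → dot x 𝟎 ≡ false
dot-𝟎ʳ []      = refl
dot-𝟎ʳ (a ∷ x) = cong₂ _xor_ (∧-zeroʳ a) (dot-𝟎ʳ x)

-- Squaring is the identity on F₂. Orthogonality of a row to `𝟏` thus follows from its orthogonality
-- to itself.
dot-𝟏ˡ : ∀ {n} (x : Vec Bool n) → dot 𝟏 x ≡ dot x x
dot-𝟏ˡ []      = refl
dot-𝟏ˡ (a ∷ x) = cong₂ _xor_ (sym (𝔹.∧-idem a)) (dot-𝟏ˡ x)

-- A tuple of m codewords is read by columns as N points of F₂ᵐ.
col : ∀ {m N} → Vec (Vec Bool N) m → Fin N → Vec Bool m
col t j = V.map (λ c → lookup c j) t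

lookup-col : ∀ {m N} (t : Vec (Vec Bool N) m) j i → lookup (col t j) i ≡ lookup (lookup t i) j
lookup-col t j i = lookup-map i (λ c → lookup c j) t

col-ext : ∀ {m N} {t t' : Vec (Vec Bool N) m} → (∀ j → col t j ≡ col t' j) → t ≡ t'
col-ext {t = t} {t'} h = lookup-ext λ i → lookup-ext λ j →
  trans (sym (lookup-col t j i)) (trans (cong (λ v → lookup v i) (h j)) (lookup-col t' j i))

lookup-combo : ∀ {N k} (ls : Vec Bool k) (t : Vec (Vec Bool N) k) j → lookup (combo ls t) j ≡ dot ls (col t j)
lookup-combo []           []      j = lookup-replicate j false
lookup-combo (true ∷ ls)  (g ∷ t) j = trans (lookup-zipWith _xor_ j g _) (cong (lookup g j xor_) (lookup-combo ls t j))
lookup-combo (false ∷ ls) (g ∷ t) j = trans (cong (λ x → lookup x j) (⊕-identityˡ (combo ls t))) (lookup-combo ls t j)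

-- Multiplicities and the sign characters

opaque
  count : ∀ {n} → (Fin n → Bool) → ℕ
  count {zero}  P = 0
  count {suc n} P = (if P zero then 1 else 0) + count (P ∘ suc)

  length-filter-tabulate : ∀ {A : Set} {n} (P : A → Bool) (g : Fin n → A) →
    length (filterᵇ P (L.tabulate g)) ≡ count (P ∘ g)
  length-filter-tabulate {n = zero}  P g = refl
  length-filter-tabulate {n = suc n} P g with P (g zero)
  ... | true  = cong suc (length-filter-tabulate P (g ∘ suc))
  ... | false = length-filter-tabulate P (g ∘ suc)

  count-cong : ∀ {n} {P Q : Fin n → Bool} → (∀ i → P i ≡ Q i) → count P ≡ count Q
  count-cong {zero}  h = refl
  count-cong {suc n} h = cong₂ (λ b k → (if b then 1 else 0) + k) (h zero) (count-cong (h ∘ suc))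

cweMonomial-count : ∀ {m N} (t : Vec (Vec Bool N) m) v → cweMonomial t v ≡ count (λ j → eqV (col t j) v)
cweMonomial-count t v = length-filter-tabulate (λ j → eqV (col t j) v) id

opaque
  unfolding ⨁ count
  odd-count : ∀ {n} (P : Fin n → Bool) → oddᵇ (count P) ≡ ⨁ P
  odd-count {zero}  P = refl
  odd-count {suc n} P with P zero
  ... | true  = trans (if-not (oddᵇ (count (P ∘ suc)))) (cong not (odd-count (P ∘ suc)))
    where
      if-not : ∀ b → (if b then false else true) ≡ not b
      if-not true  = refl
      if-not false = refl
  ... | false = odd-count (P ∘ suc)

quadForm-⨁ : ∀ {m} (c : Mat m) v →
  quadForm c v ≡ ⨁ (λ i → ⨁ (λ k → ⌊ i F.≤? k ⌋ ∧ c i k ∧ lookup v i ∧ lookup v k))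
quadForm-⨁ {m} c v = trans (xorSum-concatMap _ id) (⨁-cong λ i → xorSum-tabulate _ id)

signChar : ∀ {m} → Mat m → Bool → Monomial m → Bool
signChar {m} c a e = xorSum (L.map (λ v → (quadForm c v xor a) ∧ oddᵇ (e v)) (allVecs m))

signChar-cong : ∀ {m} (c : Mat m) a {e e' : Monomial m} → (∀ v → e v ≡ e' v) → signChar c a e ≡ signChar c a e'
signChar-cong c a h = xorSum-cong (λ v → cong (λ n → (quadForm c v xor a) ∧ oddᵇ n) (h v)) (allVecs _)

-- The coefficients of the form paired with the Gram matrix of the rows. The last summand is `a`
-- times the parity of N, written as a dot product so that it too is an orthogonality condition.
gramForm : ∀ {m N} → Mat m → Bool → Vec (Vec Bool N) m → Bool
gramForm {N = N} c a t =
  ⨁ (λ i → ⨁ (λ k → ⌊ i F.≤? k ⌋ ∧ c i k ∧ dot (lookup t i) (lookup t k))) xor (a ∧ dot 𝟏 (𝟏 {N}))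

-- Only points of odd exponent count, so the sum over points is the sum of q + a over the columns.
-- Summing over columns first turns the product of coordinates i and k into the dot product of rows
-- i and k.
signChar-cweMonomial : ∀ {m N} (c : Mat m) a (t : Vec (Vec Bool N) m) → signChar c a (cweMonomial t) ≡ gramForm c a t
signChar-cweMonomial {m} {N} c a t = begin
  signChar c a (cweMonomial t)
    ≡⟨ xorSum-cong (λ v → cong (h v ∧_)
         (trans (cong oddᵇ (cweMonomial-count t v)) (odd-count _))) (allVecs m) ⟩
  xorSum (L.map (λ v → h v ∧ ⨁ (λ j → eqV (col t j) v)) (allVecs m))
    ≡⟨ xorSum-cong (λ v → sym (⨁-∧ (h v) _)) (allVecs m) ⟩
  xorSum (L.map (λ v → ⨁ (λ j → h v ∧ eqV (col t j) v)) (allVecs m))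
    ≡⟨ xorSum-⨁ _ (allVecs m) ⟩
  ⨁ (λ j → xorSum (L.map (λ v → h v ∧ eqV (col t j) v) (allVecs m)))
    ≡⟨ ⨁-cong (λ j → xorSum-delta h (col t j)) ⟩
  ⨁ (λ j → quadForm c (col t j) xor a)
    ≡⟨ ⨁-xor (λ j → quadForm c (col t j)) (λ _ → a) ⟩
  ⨁ (λ j → quadForm c (col t j)) xor ⨁ {N} (λ _ → a)
    ≡⟨ cong₂ _xor_ quadratic constant ⟩
  gramForm c a t ∎
  where
    h : Vec Bool m → Bool
    h v = quadForm c v xor a
    constant : ⨁ {N} (λ _ → a) ≡ a ∧ dot 𝟏 (𝟏 {N})
    constant = begin
      ⨁ {N} (λ _ → a)
        ≡⟨ ⨁-cong {N} (λ j → sym (trans (cong (a ∧_) (cong₂ _∧_ (lookup-replicate j true) (lookup-replicate j true))) (∧-identityʳ a))) ⟩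
      ⨁ {N} (λ j → a ∧ (lookup (𝟏 {N}) j ∧ lookup (𝟏 {N}) j)) ≡⟨ ⨁-∧ a _ ⟩
      a ∧ ⨁ (λ j → lookup (𝟏 {N}) j ∧ lookup (𝟏 {N}) j)   ≡⟨ cong (a ∧_) (sym (dot-⨁ (𝟏 {N}) 𝟏)) ⟩
      a ∧ dot 𝟏 (𝟏 {N})                           ∎
    summand : ∀ i k → ⨁ (λ j → ⌊ i F.≤? k ⌋ ∧ c i k ∧ lookup (col t j) i ∧ lookup (col t j) k)
            ≡ ⌊ i F.≤? k ⌋ ∧ c i k ∧ dot (lookup t i) (lookup t k)
    summand i k = begin
      ⨁ (λ j → ⌊ i F.≤? k ⌋ ∧ (c i k ∧ (lookup (col t j) i ∧ lookup (col t j) k)))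
        ≡⟨ ⨁-∧ ⌊ i F.≤? k ⌋ _ ⟩
      ⌊ i F.≤? k ⌋ ∧ ⨁ (λ j → c i k ∧ (lookup (col t j) i ∧ lookup (col t j) k))
        ≡⟨ cong (⌊ i F.≤? k ⌋ ∧_) (⨁-∧ (c i k) _) ⟩
      ⌊ i F.≤? k ⌋ ∧ (c i k ∧ ⨁ (λ j → lookup (col t j) i ∧ lookup (col t j) k))
        ≡⟨ cong (λ b → ⌊ i F.≤? k ⌋ ∧ (c i k ∧ b))
             (trans (⨁-cong (λ j → cong₂ _∧_ (lookup-col t j i) (lookup-col t j k))) (sym (dot-⨁ (lookup t i) (lookup t k)))) ⟩
      ⌊ i F.≤? k ⌋ ∧ (c i k ∧ dot (lookup t i) (lookup t k)) ∎
    quadratic : ⨁ (λ j → quadForm c (col t j))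
              ≡ ⨁ (λ i → ⨁ (λ k → ⌊ i F.≤? k ⌋ ∧ c i k ∧ dot (lookup t i) (lookup t k)))
    quadratic = begin
      ⨁ (λ j → quadForm c (col t j))
        ≡⟨ ⨁-cong (λ j → quadForm-⨁ c (col t j)) ⟩
      ⨁ (λ j → ⨁ (λ i → ⨁ (λ k → ⌊ i F.≤? k ⌋ ∧ c i k ∧ lookup (col t j) i ∧ lookup (col t j) k)))
        ≡⟨ ⨁-swap _ ⟩
      ⨁ (λ i → ⨁ (λ j → ⨁ (λ k → ⌊ i F.≤? k ⌋ ∧ c i k ∧ lookup (col t j) i ∧ lookup (col t j) k)))
        ≡⟨ ⨁-cong (λ i → trans (⨁-swap _) (⨁-cong (summand i))) ⟩
      _ ∎

module _ {m N : ℕ} (t : Vec (Vec Bool N) m) (h : ∀ c a → signChar c a (cweMonomial t) ≡ false) where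

  -- The test element is the matrix -1: the zero form with a = 1.
  signs-fix⇒even : dot 𝟏 (𝟏 {N}) ≡ false
  signs-fix⇒even = trans
    (sym (cong (_xor dot 𝟏 (𝟏 {N})) (⨁-false {m} (λ i → ⨁-false (λ k → ∧-zeroʳ ⌊ i F.≤? k ⌋)))))
    (trans (sym (signChar-cweMonomial (λ _ _ → false) true t)) (h _ _))

  -- The test element is the form x_i x_k, with coefficient matrix `δ`; for i = k it is x_i².
  -- `quadForm` reads coefficients only for i ≤ k, hence the restriction, which symmetry of `dot`
  -- removes afterwards.
  signs-fix⇒orthogonal-≤ : ∀ i k → i F.≤ k → dot (lookup t i) (lookup t k) ≡ false
  signs-fix⇒orthogonal-≤ i k i≤k = begin
    dot (lookup t i) (lookup t k)
      ≡⟨ sym at-ik ⟩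
    entry i k
      ≡⟨ sym (⨁-delta k (entry i) (λ k' ne → vanish i k' (λ { (_ , eq) → ne eq }))) ⟩
    ⨁ (entry i)
      ≡⟨ sym (⨁-delta i _ (λ i' ne → ⨁-false (λ k' → vanish i' k' (λ { (eq , _) → ne eq })))) ⟩
    ⨁ (λ i' → ⨁ (entry i'))
      ≡⟨ sym (xor-identityʳ _) ⟩
    gramForm δ false t
      ≡⟨ sym (signChar-cweMonomial δ false t) ⟩
    signChar δ false (cweMonomial t)
      ≡⟨ h δ false ⟩
    false ∎
    where
      δ : Mat m
      δ i' k' = ⌊ i' F.≟ i ⌋ ∧ ⌊ k' F.≟ k ⌋
      entry : Fin m → Fin m → Bool
      entry i' k' = ⌊ i' F.≤? k' ⌋ ∧ δ i' k' ∧ dot (lookup t i') (lookup t k')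
      vanish : ∀ i' k' → ¬ (i' ≡ i × k' ≡ k) → entry i' k' ≡ false
      vanish i' k' ne with i' F.≟ i | k' F.≟ k
      ... | yes p | yes q = contradiction (p , q) ne
      ... | yes _ | no _  = ∧-zeroʳ ⌊ i' F.≤? k' ⌋
      ... | no _  | _     = ∧-zeroʳ ⌊ i' F.≤? k' ⌋
      at-ik : entry i k ≡ dot (lookup t i) (lookup t k)
      at-ik with i F.≤? k | i F.≟ i | k F.≟ k
      ... | no n | _ | _ = contradiction i≤k n
      ... | yes _ | no n | _ = contradiction refl n
      ... | yes _ | yes _ | no n = contradiction refl n
      ... | yes _ | yes _ | yes _ = refl

  signs-fix⇒orthogonal : ∀ i k → dot (lookup t i) (lookup t k) ≡ false
  signs-fix⇒orthogonal i k with FP.≤-total i k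
  ... | inj₁ i≤k = signs-fix⇒orthogonal-≤ i k i≤k
  ... | inj₂ k≤i = trans (dot-comm (lookup t i) (lookup t k)) (signs-fix⇒orthogonal-≤ k i k≤i)

-- Spans and elementary moves

Subset : ℕ → Set₁
Subset N = Vec Bool N → Set

record Subspace {N} (W : Subset N) : Set where
  field
    has-𝟎  : W 𝟎
    closed : ∀ {x y} → W x → W y → W (x ⊕ y)
    dec    : ∀ x → Dec (W x)
open Subspace

infixl 6 _+⟨_⟩
-- Over F₂ the only multiples of y are 0 and y, so adjoining y to a subspace gives the union of two
-- cosets.
_+⟨_⟩ : ∀ {N} → Subset N → Vec Bool N → Subset N
(W +⟨ y ⟩) x = W x ⊎ W (x ⊕ y)

+⟨⟩-subspace : ∀ {N} {W : Subset N} → Subspace W → ∀ y → Subspace (W +⟨ y ⟩)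
+⟨⟩-subspace S y .has-𝟎 = inj₁ (has-𝟎 S)
+⟨⟩-subspace S y .closed (inj₁ p) (inj₁ q) = inj₁ (closed S p q)
+⟨⟩-subspace {W = W} S y .closed {u} {v} (inj₁ p) (inj₂ q) = inj₂ (subst W (sym (⊕-assoc u v y)) (closed S p q))
+⟨⟩-subspace {W = W} S y .closed {u} {v} (inj₂ p) (inj₁ q) = inj₂ (subst W (⊕-swapʳ u y v) (closed S p q))
+⟨⟩-subspace {W = W} S y .closed {u} {v} (inj₂ p) (inj₂ q) = inj₁ (subst W (⊕-cancel-mid u v y) (closed S p q))
+⟨⟩-subspace S y .dec x = dec S x ⊎-dec dec S (x ⊕ y)

+⟨⟩-mono : ∀ {N} {W W' : Subset N} {y} → W ⊆ W' → W +⟨ y ⟩ ⊆ W' +⟨ y ⟩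
+⟨⟩-mono s (inj₁ p) = inj₁ (s p)
+⟨⟩-mono s (inj₂ p) = inj₂ (s p)

-- Taken relative to a base that grows along the tuple, so that an induction passes to the tail by
-- enlarging W.
Span : ∀ {N n} → Subset N → Vec (Vec Bool N) n → Subset N
Span W []      = W
Span W (y ∷ t) = Span (W +⟨ y ⟩) t

Span-mono : ∀ {N n} {W W' : Subset N} (t : Vec (Vec Bool N) n) → W ⊆ W' → Span W t ⊆ Span W' t
Span-mono []      s = s
Span-mono (y ∷ t) s = Span-mono t (+⟨⟩-mono (λ {x} → s {x}))

Span-base : ∀ {N n} {W : Subset N} (t : Vec (Vec Bool N) n) → W ⊆ Span W t
Span-base []      p = p
Span-base (y ∷ t) p = Span-base t (inj₁ p)

+⟨⟩-self : ∀ {N} {W : Subset N} → Subspace W → ∀ y → (W +⟨ y ⟩) y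
+⟨⟩-self {W = W} S y = inj₂ (subst W (sym (⊕-self y)) (has-𝟎 S))

+⟨⟩-least : ∀ {N} {W X : Subset N} {y} → Subspace X → W ⊆ X → X y → W +⟨ y ⟩ ⊆ X
+⟨⟩-least S s q (inj₁ p) = s p
+⟨⟩-least {X = X} {y} S s q {x} (inj₂ p) = subst X (⊕-cancelʳ x y) (closed S (s p) q)

Span-least : ∀ {N n} {W X : Subset N} (t : Vec (Vec Bool N) n) → Subspace X → W ⊆ X → (∀ i → X (lookup t i)) → Span W t ⊆ X
Span-least []      S s h = s
Span-least (y ∷ t) S s h = Span-least t S (+⟨⟩-least S s (h zero)) (h ∘ suc)

Span-lookup : ∀ {N n} {W : Subset N} → Subspace W → (t : Vec (Vec Bool N) n) → ∀ i → Span W t (lookup t i)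
Span-lookup S (y ∷ t) zero    = Span-base t (+⟨⟩-self S y)
Span-lookup S (y ∷ t) (suc i) = Span-lookup (+⟨⟩-subspace S y) t i

Span-combo : ∀ {N n} {W : Subset N} → Subspace W → ∀ {w} → W w → (ls : Vec Bool n) (t : Vec (Vec Bool N) n) → Span W t (w ⊕ combo ls t)
Span-combo {W = W} S {w} p [] [] = subst W (sym (⊕-identityʳ w)) p
Span-combo {W = W} S {w} p (l ∷ ls) (y ∷ t) = subst (Span _ t) (⊕-assoc w (if l then y else 𝟎) (combo ls t))
  (Span-combo S' (closed S' (inj₁ p) (multiple l)) ls t)
  where
    S' = +⟨⟩-subspace S y
    multiple : ∀ l → (W +⟨ y ⟩) (if l then y else 𝟎)
    multiple true  = +⟨⟩-self S y
    multiple false = has-𝟎 S'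

infix 4 _⊢_~_
-- Elementary row operations modulo W: a row may also be changed by an element of W. The number of
-- rows is kept even if they are dependent, which matches the fixed number m of coordinates of a
-- column.
data _⊢_~_ {N} (W : Subset N) : ∀ {n} → Vec (Vec Bool N) n → Vec (Vec Bool N) n → Set where
  ~-refl  : ∀ {n} {t : Vec _ n} → W ⊢ t ~ t
  ~-trans : ∀ {n} {t u v : Vec _ n} → W ⊢ t ~ u → W ⊢ u ~ v → W ⊢ t ~ v
  ~-cons  : ∀ {n x} {t u : Vec _ n} → W ⊢ t ~ u → W ⊢ x ∷ t ~ x ∷ u
  ~-shift : ∀ {n x w} {t : Vec _ n} → W w → W ⊢ x ∷ t ~ (x ⊕ w) ∷ t
  ~-add   : ∀ {n x y} {t : Vec _ n} → W ⊢ x ∷ y ∷ t ~ (x ⊕ y) ∷ y ∷ t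
  ~-swap  : ∀ {n x y} {t : Vec _ n} → W ⊢ x ∷ y ∷ t ~ y ∷ x ∷ t

~-sym : ∀ {N n} {W : Subset N} {t u : Vec _ n} → W ⊢ t ~ u → W ⊢ u ~ t
~-sym ~-refl        = ~-refl
~-sym (~-trans p q) = ~-trans (~-sym q) (~-sym p)
~-sym (~-cons p)    = ~-cons (~-sym p)
~-sym {W = W} (~-shift {x = x} {w} {t} p) = subst (λ z → W ⊢ (x ⊕ w) ∷ t ~ z ∷ t) (⊕-cancelʳ x w) (~-shift p)
~-sym {W = W} (~-add {x = x} {y} {t})     = subst (λ z → W ⊢ (x ⊕ y) ∷ y ∷ t ~ z ∷ y ∷ t) (⊕-cancelʳ x y) ~-add
~-sym ~-swap        = ~-swap

-- A row x that is kept can replace its presence in the base. The one real case is a shift by w with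
-- w + x in W: adding the row x and then shifting by w + x amounts to adding w.
~-lift : ∀ {N n x} {W : Subset N} {t u : Vec _ n} → W +⟨ x ⟩ ⊢ t ~ u → W ⊢ x ∷ t ~ x ∷ u
~-lift ~-refl             = ~-refl
~-lift (~-trans p q)      = ~-trans (~-lift p) (~-lift q)
~-lift (~-cons p)         = ~-trans ~-swap (~-trans (~-cons (~-lift p)) ~-swap)
~-lift (~-shift (inj₁ p)) = ~-trans ~-swap (~-trans (~-shift p) ~-swap)
~-lift {x = x} {W} (~-shift {x = y} {w} {t} (inj₂ p)) =
  ~-trans ~-swap (~-trans ~-add (~-trans
    (subst (λ z → W ⊢ (y ⊕ x) ∷ x ∷ t ~ z ∷ x ∷ t) eq (~-shift p)) ~-swap))
  where
    eq : (y ⊕ x) ⊕ (w ⊕ x) ≡ y ⊕ w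
    eq = ⊕-cancel-mid y w x
~-lift ~-add  = ~-cons ~-add
~-lift ~-swap = ~-cons ~-swap

-- The base X may exceed W because below `~-cons` the head has joined the base while the moves are
-- still moves modulo W.
Span-~ : ∀ {N n} {W X : Subset N} {t u : Vec _ n} → W ⊢ t ~ u → W ⊆ X → Subspace X → Span X t ⊆ Span X u
Span-~ ~-refl        s S = id
Span-~ (~-trans p q) s S = Span-~ q s S ∘ Span-~ p s S
Span-~ (~-cons {x = x} p) s S = Span-~ p (inj₁ ∘ s) (+⟨⟩-subspace S x)
Span-~ {X = X} (~-shift {x = x} {w} {t} p) s S = Span-mono t (+⟨⟩-least S' inj₁
  (subst (X +⟨ x ⊕ w ⟩) (⊕-cancelʳ x w) (closed S' (+⟨⟩-self S (x ⊕ w)) (inj₁ (s p)))))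
  where S' = +⟨⟩-subspace S (x ⊕ w)
Span-~ {X = X} (~-add {x = x} {y} {t}) s S = Span-mono t (+⟨⟩-least S″ (+⟨⟩-least S″ (inj₁ ∘ inj₁)
  (subst (X +⟨ x ⊕ y ⟩ +⟨ y ⟩) (⊕-cancelʳ x y) (closed S″ (inj₁ (+⟨⟩-self S (x ⊕ y))) (+⟨⟩-self S' y))))
  (+⟨⟩-self S' y))
  where
    S' = +⟨⟩-subspace S (x ⊕ y)
    S″ = +⟨⟩-subspace S' y
Span-~ (~-swap {x = x} {y} {t}) s S = Span-mono t (+⟨⟩-least S″ (+⟨⟩-least S″ (inj₁ ∘ inj₁)
  (+⟨⟩-self S' x)) (inj₁ (+⟨⟩-self S y)))
  where
    S' = +⟨⟩-subspace S y
    S″ = +⟨⟩-subspace S' x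

-- The row y at which z first becomes dependent enters z with coefficient 1, so a shift modulo the
-- earlier rows turns y into z. The recursion runs modulo those earlier rows, and `~-lift` brings
-- its result back.
exchange : ∀ {N n} {W : Subset N} → Subspace W → (t : Vec (Vec Bool N) (suc n)) → ∀ {z} →
  Span W t z → ¬ W z → Σ (Vec (Vec Bool N) n) λ u → W ⊢ t ~ z ∷ u
exchange {W = W} S (y ∷ t) {z} p ¬q with dec (+⟨⟩-subspace S y) z
... | yes (inj₁ q) = contradiction q ¬q
... | yes (inj₂ q) = t , subst (λ v → W ⊢ y ∷ t ~ v ∷ t) (trans (⊕-comm y (z ⊕ y)) (⊕-cancelʳ z y)) (~-shift q)
exchange S (y ∷ []) p ¬q | no ¬r = contradiction p ¬r
exchange S (y ∷ t@(_ ∷ _)) p ¬q | no ¬r with exchange (+⟨⟩-subspace S y) t p ¬r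
... | u , r = y ∷ u , ~-trans (~-lift r) ~-swap

-- Working modulo a growing W makes a comparison of dimensions unnecessary.
same-span⇒~ : ∀ {N n} {W : Subset N} → Subspace W → (t u : Vec (Vec Bool N) n) →
  Span W t ⊆ Span W u → Span W u ⊆ Span W t → W ⊢ t ~ u
same-span⇒~ S [] [] p q = ~-refl
same-span⇒~ {W = W} S (x ∷ t) (y ∷ u) p q with dec S x | dec S y
-- Both heads are trivial modulo W: a shift makes them equal, and the tails already have the same
-- span.
... | yes Wx | yes Wy = ~-trans
  (subst (λ z → W ⊢ x ∷ t ~ z ∷ t) x⊕x⊕y≡y (~-shift (closed S Wx Wy)))
  (~-cons (same-span⇒~ S t u
    (Span-mono u (+⟨⟩-least S id Wy) ∘ p ∘ Span-mono t inj₁)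
    (Span-mono t (+⟨⟩-least S id Wx) ∘ q ∘ Span-mono u inj₁)))
  where
    x⊕x⊕y≡y : x ⊕ (x ⊕ y) ≡ y
    x⊕x⊕y≡y = trans (⊕-comm x (x ⊕ y)) (trans (cong (_⊕ x) (⊕-comm x y)) (⊕-cancelʳ y x))
-- A nontrivial head is exchanged into the other tuple; the tails are then compared modulo W and
-- this common row.
... | _ | no ¬Wy with exchange S (x ∷ t) (q (Span-lookup S (y ∷ u) zero)) ¬Wy
... | t' , r = ~-trans r (~-lift (same-span⇒~ (+⟨⟩-subspace S y) t' u
  (p ∘ Span-~ (~-sym r) id S) (Span-~ r id S ∘ q)))
same-span⇒~ S (x ∷ t) (y ∷ u) p q | no ¬Wx | yes _ with exchange S (y ∷ u) (p (Span-lookup S (x ∷ t) zero)) ¬Wx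
... | u' , r = ~-trans (~-lift (same-span⇒~ (+⟨⟩-subspace S x) t u'
  (Span-~ r id S ∘ p) (q ∘ Span-~ (~-sym r) id S))) (~-sym r)

-- Affine maps

Additive : ∀ {m} → (Vec Bool m → Vec Bool m) → Set
Additive φ = ∀ x y → φ (x ⊕ y) ≡ φ x ⊕ φ y

unit : ∀ {m} → Fin m → Vec Bool m
unit zero    = true ∷ 𝟎
unit (suc i) = false ∷ unit i

matVec-⨁ : ∀ {m} (A : Mat m) v i → lookup (matVec A v) i ≡ ⨁ (λ j → A i j ∧ lookup v j)
matVec-⨁ A v i = trans (lookup∘tabulate _ i) (xorSum-tabulate _ id)

xor-idempotent : ∀ b → b ≡ b xor b → b ≡ false
xor-idempotent false _ = refl
xor-idempotent true  h = h

opaque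
  unfolding ⨁

  additive⇒⨁ : ∀ {m} (f : Vec Bool m → Bool) → (∀ x y → f (x ⊕ y) ≡ f x xor f y) →
    ∀ v → ⨁ (λ j → f (unit j) ∧ lookup v j) ≡ f v
  additive⇒⨁ f add [] = sym (xor-idempotent (f []) (add [] []))
  additive⇒⨁ {suc m} f add (a ∷ v) = begin
    (f (true ∷ 𝟎) ∧ a) xor ⨁ (λ j → f (false ∷ unit j) ∧ lookup v j)
      ≡⟨ cong₂ _xor_ (head a) (additive⇒⨁ (f ∘ (false ∷_)) (λ x y → add (false ∷ x) (false ∷ y)) v) ⟩
    f (a ∷ 𝟎) xor f (false ∷ v)
      ≡⟨ sym (add (a ∷ 𝟎) (false ∷ v)) ⟩
    f ((a xor false) ∷ (𝟎 ⊕ v))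
      ≡⟨ cong f (cong₂ _∷_ (xor-identityʳ a) (⊕-identityˡ v)) ⟩
    f (a ∷ v) ∎
    where
      head : ∀ a → f (true ∷ 𝟎) ∧ a ≡ f (a ∷ 𝟎)
      head true  = ∧-identityʳ _
      head false = trans (∧-zeroʳ _) (sym (xor-idempotent (f 𝟎)
        (trans (cong f (sym (⊕-self (𝟎 {suc m})))) (add 𝟎 𝟎))))

matrixOf : ∀ {m} → (Vec Bool m → Vec Bool m) → Mat m
matrixOf φ i j = lookup (φ (unit j)) i

matVec-matrixOf : ∀ {m} {φ : Vec Bool m → Vec Bool m} → Additive φ → ∀ v → matVec (matrixOf φ) v ≡ φ v
matVec-matrixOf {φ = φ} add v = lookup-ext λ i → trans (matVec-⨁ (matrixOf φ) v i)
  (additive⇒⨁ (λ x → lookup (φ x) i)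
    (λ x y → trans (cong (λ z → lookup z i) (add x y)) (lookup-zipWith _xor_ i (φ x) (φ y))) v)

-- Row moves as seen on the columns. Additive functions with additive inverses compose without
-- matrix products; matrices enter only when a group element is required.
record AffinelyRelated {m N} (t u : Vec (Vec Bool N) m) : Set where
  field
    φ φ⁻¹        : Vec Bool m → Vec Bool m
    shift        : Vec Bool m
    φ-additive   : Additive φ
    φ⁻¹-additive : Additive φ⁻¹
    φ-φ⁻¹        : ∀ v → φ (φ⁻¹ v) ≡ v
    φ⁻¹-φ        : ∀ v → φ⁻¹ (φ v) ≡ v
    col-map      : ∀ j → col u j ≡ φ (col t j) ⊕ shift
open AffinelyRelated

-- The span of `𝟏` alone. With this base a nontrivial shift adds `𝟏` to a row, which is a
-- translation of the columns.
𝟎𝟏 : ∀ {N} → Subset N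
𝟎𝟏 = (λ x → x ≡ 𝟎) +⟨ 𝟏 ⟩

_≟V_ : ∀ {n} (x y : Vec Bool n) → Dec (x ≡ y)
_≟V_ = VP.≡-dec 𝔹._≟_

𝟎-subspace : ∀ {N} → Subspace {N} (λ x → x ≡ 𝟎)
𝟎-subspace .has-𝟎 = refl
𝟎-subspace .closed refl refl = ⊕-self 𝟎
𝟎-subspace .dec x = x ≟V 𝟎

𝟎𝟏-subspace : ∀ {N} → Subspace {N} 𝟎𝟏
𝟎𝟏-subspace = +⟨⟩-subspace 𝟎-subspace 𝟏

lookup-𝟎𝟏 : ∀ {N} {w : Vec Bool N} → 𝟎𝟏 w → Σ Bool λ a → ∀ j → lookup w j ≡ a
lookup-𝟎𝟏 (inj₁ refl) = false , λ j → lookup-replicate j false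
lookup-𝟎𝟏 {w = w} (inj₂ p) = true , λ j → begin
  lookup w j                 ≡⟨ cong (λ x → lookup x j) (sym (⊕-cancelʳ w 𝟏)) ⟩
  lookup ((w ⊕ 𝟏) ⊕ 𝟏) j     ≡⟨ cong (λ x → lookup (x ⊕ 𝟏) j) p ⟩
  lookup (𝟎 ⊕ 𝟏) j           ≡⟨ cong (λ x → lookup x j) (⊕-identityˡ 𝟏) ⟩
  lookup 𝟏 j                 ≡⟨ lookup-replicate j true ⟩
  true                       ∎

-- Each move acts in the same way on every column: a shift adds a constant to the first coordinate,
-- because a word of `𝟎𝟏` is constant, while `~-add` and `~-swap` are linear involutions.
~⇒affine : ∀ {m N} {t u : Vec (Vec Bool N) m} → 𝟎𝟏 ⊢ t ~ u → AffinelyRelated t u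
~⇒affine ~-refl = record
  { φ = id ; φ⁻¹ = id ; shift = 𝟎
  ; φ-additive = λ _ _ → refl ; φ⁻¹-additive = λ _ _ → refl
  ; φ-φ⁻¹ = λ _ → refl ; φ⁻¹-φ = λ _ → refl
  ; col-map = λ j → sym (⊕-identityʳ _) }
~⇒affine {t = t} (~-trans {u = u} p q) = record
  { φ = φ Q ∘ φ P ; φ⁻¹ = φ⁻¹ P ∘ φ⁻¹ Q ; shift = φ Q (shift P) ⊕ shift Q
  ; φ-additive = λ x y → trans (cong (φ Q) (φ-additive P x y)) (φ-additive Q _ _)
  ; φ⁻¹-additive = λ x y → trans (cong (φ⁻¹ P) (φ⁻¹-additive Q x y)) (φ⁻¹-additive P _ _)
  ; φ-φ⁻¹ = λ v → trans (cong (φ Q) (φ-φ⁻¹ P _)) (φ-φ⁻¹ Q v)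
  ; φ⁻¹-φ = λ v → trans (cong (φ⁻¹ P) (φ⁻¹-φ Q _)) (φ⁻¹-φ P v)
  ; col-map = λ j → trans (col-map Q j) (trans (cong (λ v → φ Q v ⊕ shift Q) (col-map P j))
      (trans (cong (_⊕ shift Q) (φ-additive Q _ _)) (⊕-assoc _ (φ Q (shift P)) (shift Q)))) }
  where
    P = ~⇒affine p
    Q = ~⇒affine q
~⇒affine (~-cons p) = record
  { φ = λ { (a ∷ v) → a ∷ φ P v } ; φ⁻¹ = λ { (a ∷ v) → a ∷ φ⁻¹ P v } ; shift = false ∷ shift P
  ; φ-additive = λ { (a ∷ x) (c ∷ y) → cong (_ ∷_) (φ-additive P x y) }
  ; φ⁻¹-additive = λ { (a ∷ x) (c ∷ y) → cong (_ ∷_) (φ⁻¹-additive P x y) }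
  ; φ-φ⁻¹ = λ { (a ∷ v) → cong (a ∷_) (φ-φ⁻¹ P v) }
  ; φ⁻¹-φ = λ { (a ∷ v) → cong (a ∷_) (φ⁻¹-φ P v) }
  ; col-map = λ j → cong₂ _∷_ (sym (xor-identityʳ _)) (col-map P j) }
  where P = ~⇒affine p
~⇒affine (~-shift {x = x} {w} p) with lookup-𝟎𝟏 p
... | a , h = record
  { φ = id ; φ⁻¹ = id ; shift = a ∷ 𝟎
  ; φ-additive = λ _ _ → refl ; φ⁻¹-additive = λ _ _ → refl
  ; φ-φ⁻¹ = λ _ → refl ; φ⁻¹-φ = λ _ → refl
  ; col-map = λ j → cong₂ _∷_ (trans (lookup-zipWith _xor_ j x w) (cong (lookup x j xor_) (h j))) (sym (⊕-identityʳ _)) }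
~⇒affine {suc (suc m)} (~-add {x = x} {y}) = record
  { φ = add ; φ⁻¹ = add ; shift = 𝟎
  ; φ-additive = add-additive ; φ⁻¹-additive = add-additive
  ; φ-φ⁻¹ = add-involutive ; φ⁻¹-φ = add-involutive
  ; col-map = λ j → trans (cong (_∷ _) (lookup-zipWith _xor_ j x y)) (sym (⊕-identityʳ _)) }
  where
    add : Vec Bool (suc (suc m)) → Vec Bool (suc (suc m))
    add (a ∷ c ∷ v) = (a xor c) ∷ c ∷ v
    add-additive : Additive add
    add-additive (a ∷ c ∷ u) (a' ∷ c' ∷ v) = cong (_∷ _) (xor-interchange a a' c c')
    add-involutive : ∀ v → add (add v) ≡ v
    add-involutive (a ∷ c ∷ v) = cong (_∷ _) (trans (xor-assoc a c c)
      (trans (cong (a xor_) (xor-same c)) (xor-identityʳ a)))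
~⇒affine ~-swap = record
  { φ = exch ; φ⁻¹ = exch ; shift = 𝟎
  ; φ-additive = exch-additive ; φ⁻¹-additive = exch-additive
  ; φ-φ⁻¹ = exch-involutive ; φ⁻¹-φ = exch-involutive
  ; col-map = λ j → sym (⊕-identityʳ _) }
  where
    exch : ∀ {m} → Vec Bool (suc (suc m)) → Vec Bool (suc (suc m))
    exch (a ∷ c ∷ v) = c ∷ a ∷ v
    exch-additive : ∀ {m} → Additive (exch {m})
    exch-additive (_ ∷ _ ∷ _) (_ ∷ _ ∷ _) = refl
    exch-involutive : ∀ {m} (v : Vec Bool (suc (suc m))) → exch (exch v) ≡ v
    exch-involutive (_ ∷ _ ∷ _) = refl

-- Multisets of columns

opaque
  unfolding count

  count-positive : ∀ {n} (P : Fin n → Bool) → count P ≢ 0 → Σ (Fin n) λ j → P j ≡ true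
  count-positive {zero}  P h = contradiction refl h
  count-positive {suc n} P h with P zero in eq
  ... | true = zero , eq
  ... | false with count-positive (P ∘ suc) h
  ... | j , p = suc j , p

  count-punchIn : ∀ {n} (P : Fin (suc n) → Bool) j → count P ≡ (if P j then 1 else 0) + count (P ∘ punchIn j)
  count-punchIn P zero = refl
  count-punchIn {suc n} P (suc j) = begin
    a + count (P ∘ suc)                             ≡⟨ cong (a +_) (count-punchIn (P ∘ suc) j) ⟩
    a + (c + count (P ∘ suc ∘ punchIn j))           ≡⟨ sym (ℕP.+-assoc a c _) ⟩
    (a + c) + count (P ∘ suc ∘ punchIn j)           ≡⟨ cong (_+ count (P ∘ suc ∘ punchIn j)) (ℕP.+-comm a c) ⟩
    (c + a) + count (P ∘ suc ∘ punchIn j)           ≡⟨ ℕP.+-assoc c a _ ⟩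
    c + (a + count (P ∘ suc ∘ punchIn j))           ∎
    where
      a c : ℕ
      a = if P zero then 1 else 0
      c = if P (suc j) then 1 else 0

  count-none : (P : Fin 0 → Bool) → count P ≡ 0
  count-none P = refl

count-member : ∀ {n} (P : Fin (suc n) → Bool) j → P j ≡ true → count P ≢ 0
count-member P j p eq with () ← trans (sym eq) (trans (count-punchIn P j) (cong (λ b → (if b then 1 else 0) + count (P ∘ punchIn j)) p))

multiplicity : ∀ {m n} → (Fin n → Vec Bool m) → Vec Bool m → ℕ
multiplicity f v = count (λ j → eqV (f j) v)

-- The first point of f has positive multiplicity in g as well, so it is matched with some g j;
-- deleting both leaves equal multiplicities.
same-multiplicities⇒permutation : ∀ {m n n'} (f : Fin n → Vec Bool m) (g : Fin n' → Vec Bool m) →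
  (∀ v → multiplicity f v ≡ multiplicity g v) → Σ (Fin n ↔ Fin n') λ σ → ∀ i → g (Inverse.to σ i) ≡ f i
same-multiplicities⇒permutation {n = zero} {zero} f g h = Perm.id , λ ()
same-multiplicities⇒permutation {n = zero} {suc n'} f g h =
  contradiction (trans (sym (h (g zero))) (count-none _)) (count-member _ zero (eqV-refl (g zero)))
same-multiplicities⇒permutation {n = suc n} {zero} f g h =
  contradiction (trans (h (f zero)) (count-none _)) (count-member _ zero (eqV-refl (f zero)))
same-multiplicities⇒permutation {n = suc n} {suc n'} f g h = insert zero j σ , matches
  where
    found : Σ (Fin (suc n')) λ j → eqV (g j) (f zero) ≡ true
    found = count-positive _ (λ eq → count-member _ zero (eqV-refl (f zero)) (trans (h (f zero)) eq))
    j = proj₁ found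
    gj≡f0 : g j ≡ f zero
    gj≡f0 = eqV⇒≡ (g j) (f zero) (proj₂ found)
    rest : ∀ v → multiplicity (f ∘ suc) v ≡ multiplicity (g ∘ punchIn j) v
    rest v = ℕP.+-cancelˡ-≡ (if eqV (f zero) v then 1 else 0) _ _ (begin
      (if eqV (f zero) v then 1 else 0) + multiplicity (f ∘ suc) v
        ≡⟨ sym (count-punchIn (λ i → eqV (f i) v) zero) ⟩
      multiplicity f v ≡⟨ h v ⟩
      multiplicity g v ≡⟨ count-punchIn (λ i → eqV (g i) v) j ⟩
      (if eqV (g j) v then 1 else 0) + multiplicity (g ∘ punchIn j) v
        ≡⟨ cong (λ x → (if eqV x v then 1 else 0) + multiplicity (g ∘ punchIn j) v) gj≡f0 ⟩
      (if eqV (f zero) v then 1 else 0) + multiplicity (g ∘ punchIn j) v ∎)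
    IH = same-multiplicities⇒permutation (f ∘ suc) (g ∘ punchIn j) rest
    σ = proj₁ IH
    matches : ∀ i → g (Inverse.to (insert zero j σ) i) ≡ f i
    matches zero    = gj≡f0
    matches (suc i) = trans (cong g (insert-punchIn zero j σ i)) (proj₂ IH i)

permuteV-lookup : ∀ {N N'} (σ : Fin N ↔ Fin N') x j → lookup (permuteV σ x) j ≡ lookup x (Inverse.from σ j)
permuteV-lookup σ x = lookup∘tabulate _

permuteV-⊕ : ∀ {N N'} (σ : Fin N ↔ Fin N') x y → permuteV σ (x ⊕ y) ≡ permuteV σ x ⊕ permuteV σ y
permuteV-⊕ σ x y = lookup-ext λ j → begin
  lookup (permuteV σ (x ⊕ y)) j                             ≡⟨ permuteV-lookup σ (x ⊕ y) j ⟩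
  lookup (x ⊕ y) (Inverse.from σ j)                         ≡⟨ lookup-zipWith _xor_ _ x y ⟩
  lookup x (Inverse.from σ j) xor lookup y (Inverse.from σ j)
    ≡⟨ sym (cong₂ _xor_ (permuteV-lookup σ x j) (permuteV-lookup σ y j)) ⟩
  lookup (permuteV σ x) j xor lookup (permuteV σ y) j       ≡⟨ sym (lookup-zipWith _xor_ j (permuteV σ x) _) ⟩
  lookup (permuteV σ x ⊕ permuteV σ y) j                    ∎

permuteV-replicate : ∀ {N N'} (σ : Fin N ↔ Fin N') a → permuteV σ (replicate N a) ≡ replicate N' a
permuteV-replicate {N} σ a = lookup-ext λ j → trans (permuteV-lookup σ (replicate N a) j)
  (trans (lookup-replicate (Inverse.from σ j) a) (sym (lookup-replicate j a)))

permuteV-flip : ∀ {N N'} (σ : Fin N ↔ Fin N') x → permuteV (Perm.flip σ) (permuteV σ x) ≡ x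
permuteV-flip σ x = lookup-ext λ j → trans (permuteV-lookup (Perm.flip σ) (permuteV σ x) j)
  (trans (permuteV-lookup σ x (Inverse.to σ j)) (cong (lookup x) (Perm.inverseˡ σ)))

permuteV-injective : ∀ {N N'} (σ : Fin N ↔ Fin N') {x y} → permuteV σ x ≡ permuteV σ y → x ≡ y
permuteV-injective σ {x} {y} eq = trans (sym (permuteV-flip σ x)) (trans (cong (permuteV (Perm.flip σ)) eq) (permuteV-flip σ y))

-- The variables commute, so a monomial forgets the order of the columns and nothing else;
-- reordering columns permutes the coordinates of every row at once.
same-monomial⇒permutation : ∀ {m N N'} (t : Vec (Vec Bool N) m) (u : Vec (Vec Bool N') m) →
  (∀ v → cweMonomial t v ≡ cweMonomial u v) → Σ (Fin N ↔ Fin N') λ σ → V.map (permuteV σ) t ≡ u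
same-monomial⇒permutation t u h = σ , col-ext λ j → lookup-ext λ i → begin
  lookup (col (V.map (permuteV σ) t) j) i       ≡⟨ lookup-col (V.map (permuteV σ) t) j i ⟩
  lookup (lookup (V.map (permuteV σ) t) i) j    ≡⟨ cong (λ x → lookup x j) (lookup-map i (permuteV σ) t) ⟩
  lookup (permuteV σ (lookup t i)) j            ≡⟨ permuteV-lookup σ (lookup t i) j ⟩
  lookup (lookup t i) (Inverse.from σ j)        ≡⟨ sym (lookup-col t (Inverse.from σ j) i) ⟩
  lookup (col t (Inverse.from σ j)) i           ≡⟨ cong (λ v → lookup v i) (sym (matches (Inverse.from σ j))) ⟩
  lookup (col u (Inverse.to σ (Inverse.from σ j))) i ≡⟨ cong (λ k → lookup (col u k) i) (Perm.inverseʳ σ) ⟩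
  lookup (col u j) i                            ∎
  where
    found = same-multiplicities⇒permutation (col t) (col u)
      (λ v → trans (sym (cweMonomial-count t v)) (trans (h v) (cweMonomial-count u v)))
    σ = proj₁ found
    matches = proj₂ found

cweMonomial-cong : ∀ {m N} {t : Vec (Vec Bool N) m} {f : Fin N → Vec Bool m} → (∀ j → col t j ≡ f j) → ∀ v → cweMonomial t v ≡ multiplicity f v
cweMonomial-cong {t = t} h v = trans (cweMonomial-count t v) (count-cong (λ j → cong (λ x → eqV x v) (h j)))

fromColumns : ∀ {m N} → (Fin N → Vec Bool m) → Vec (Vec Bool N) m
fromColumns f = tabulate (λ i → tabulate (λ j → lookup (f j) i))

col-fromColumns : ∀ {m N} (f : Fin N → Vec Bool m) j → col (fromColumns f) j ≡ f j
col-fromColumns f j = lookup-ext λ i → trans (lookup-col (fromColumns f) j i)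
  (trans (cong (λ x → lookup x j) (lookup∘tabulate _ i)) (lookup∘tabulate _ j))

points : ∀ {m} → Monomial m → List (Vec Bool m) → List (Vec Bool m)
points e = concatMap (λ v → L.replicate (e v) v)

length-filterᵇ-++ : ∀ {A : Set} (P : A → Bool) xs ys → length (filterᵇ P (xs ++ ys)) ≡ length (filterᵇ P xs) + length (filterᵇ P ys)
length-filterᵇ-++ P [] ys = refl
length-filterᵇ-++ P (x ∷ xs) ys with P x
... | true  = cong suc (length-filterᵇ-++ P xs ys)
... | false = length-filterᵇ-++ P xs ys

length-filterᵇ-replicate : ∀ {A : Set} (P : A → Bool) n x → length (filterᵇ P (L.replicate n x)) ≡ (if P x then n else 0)
length-filterᵇ-replicate P zero x with P x
... | true  = refl
... | false = refl
length-filterᵇ-replicate P (suc n) x with P x | length-filterᵇ-replicate P n x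
... | true  | h = cong suc h
... | false | h = h

points-sum : ∀ {m} (e : Monomial m) v xs →
  length (filterᵇ (λ x → eqV x v) (points e xs)) ≡ sum (L.map (λ x → if eqV x v then e x else 0) xs)
points-sum e v [] = refl
points-sum e v (x ∷ xs) = trans (length-filterᵇ-++ _ (L.replicate (e x) x) _)
  (cong₂ _+_ (length-filterᵇ-replicate _ (e x) x) (points-sum e v xs))

sum-zero : ∀ {A : Set} {f : A → ℕ} → (∀ x → f x ≡ 0) → ∀ xs → sum (L.map f xs) ≡ 0
sum-zero h [] = refl
sum-zero h (x ∷ xs) = cong₂ _+_ (h x) (sum-zero h xs)

sum-allVecs-∷ : ∀ {m} (f : Vec Bool (suc m) → ℕ) →
  sum (L.map f (allVecs (suc m))) ≡ sum (L.map (f ∘ (false ∷_)) (allVecs m)) + sum (L.map (f ∘ (true ∷_)) (allVecs m))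
sum-allVecs-∷ {m} f = begin
  sum (L.map f (L.map (false ∷_) X ++ L.map (true ∷_) X))
    ≡⟨ cong sum (LP.map-++ f (L.map (false ∷_) X) _) ⟩
  sum (L.map f (L.map (false ∷_) X) ++ L.map f (L.map (true ∷_) X))
    ≡⟨ sum-++ (L.map f (L.map (false ∷_) X)) _ ⟩
  sum (L.map f (L.map (false ∷_) X)) + sum (L.map f (L.map (true ∷_) X))
    ≡⟨ cong₂ _+_ (cong sum (sym (LP.map-∘ X))) (cong sum (sym (LP.map-∘ X))) ⟩
  _ ∎
  where X = allVecs m

sum-delta : ∀ {m} (e : Monomial m) v → sum (L.map (λ x → if eqV x v then e x else 0) (allVecs m)) ≡ e v
sum-delta e [] = ℕP.+-identityʳ _
sum-delta {suc m} e (false ∷ v) = trans (sum-allVecs-∷ (λ x → if eqV x (false ∷ v) then e x else 0))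
  (trans (cong₂ _+_ (sum-delta (e ∘ (false ∷_)) v) (sum-zero {f = λ _ → 0} (λ _ → refl) (allVecs m))) (ℕP.+-identityʳ _))
sum-delta {suc m} e (true ∷ v) = trans (sum-allVecs-∷ (λ x → if eqV x (true ∷ v) then e x else 0))
  (cong₂ _+_ (sum-zero {f = λ _ → 0} (λ _ → refl) (allVecs m)) (sum-delta (e ∘ (true ∷_)) v))

-- The variables of `e`, listed with multiplicity, become the columns, and N is the degree.
-- Coefficients can therefore be tested on monomials of tuples.
monomial-realised : ∀ {m} (e : Monomial m) → Σ ℕ λ N → Σ (Vec (Vec Bool N) m) λ t → ∀ v → cweMonomial t v ≡ e v
monomial-realised {m} e = length ps , fromColumns (L.lookup ps) , λ v → begin
  cweMonomial (fromColumns (L.lookup ps)) v ≡⟨ cweMonomial-cong {t = fromColumns (L.lookup ps)} (col-fromColumns (L.lookup ps)) v ⟩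
  multiplicity (L.lookup ps) v              ≡⟨ sym (length-filter-tabulate (λ x → eqV x v) (L.lookup ps)) ⟩
  length (filterᵇ (λ x → eqV x v) (L.tabulate (L.lookup ps))) ≡⟨ cong (λ xs → length (filterᵇ (λ x → eqV x v) xs)) (LP.tabulate-lookup ps) ⟩
  length (filterᵇ (λ x → eqV x v) ps)       ≡⟨ points-sum e v (allVecs m) ⟩
  sum (L.map (λ x → if eqV x v then e x else 0) (allVecs m)) ≡⟨ sum-delta e v ⟩
  e v ∎
  where ps = points e (allVecs m)

-- Counting codewords

∈-allVecs : ∀ {n} (x : Vec Bool n) → x ∈ allVecs n
∈-allVecs []          = here refl
∈-allVecs (false ∷ x) = ∈P.∈-++⁺ˡ (∈P.∈-map⁺ (false ∷_) (∈-allVecs x))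
∈-allVecs (true ∷ x)  = ∈P.∈-++⁺ʳ (L.map (false ∷_) (allVecs _)) (∈P.∈-map⁺ (true ∷_) (∈-allVecs x))

allVecs-unique : ∀ n → Unique (allVecs n)
allVecs-unique zero    = [] ∷ []
allVecs-unique (suc n) = Uniq.++⁺ (Uniq.map⁺ VP.∷-injectiveʳ (allVecs-unique n)) (Uniq.map⁺ VP.∷-injectiveʳ (allVecs-unique n))
  λ { (p , q) → disjoint (∈P.∈-map⁻ (false ∷_) p) (∈P.∈-map⁻ (true ∷_) q) }
  where
    disjoint : ∀ {x : Vec Bool (suc n)} → (∃ λ y → y ∈ allVecs n × x ≡ false ∷ y) → ¬ (∃ λ y → y ∈ allVecs n × x ≡ true ∷ y)
    disjoint (_ , _ , refl) (_ , _ , ())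

T⇒≡ : ∀ {b} → T b → b ≡ true
T⇒≡ {true} _ = refl

≡⇒T : ∀ {b} → b ≡ true → T b
≡⇒T refl = _

∈-codewords⁺ : ∀ {N} (C : LinearCode N) {x} → x ∈C C → x ∈ codewords C
∈-codewords⁺ C {x} p = ∈P.∈-filter⁺ _ (∈-allVecs x) (≡⇒T p)

∈-codewords⁻ : ∀ {N} (C : LinearCode N) {x} → x ∈ codewords C → x ∈C C
∈-codewords⁻ {N} C p = T⇒≡ (proj₂ (∈P.∈-filter⁻ _ {xs = allVecs N} p))

codewords-unique : ∀ {N} (C : LinearCode N) → Unique (codewords C)
codewords-unique {N} C = Uniq.filter⁺ _ (allVecs-unique N)

∣_∣C : ∀ {N} → LinearCode N → ℕ
∣ C ∣C = length (codewords C)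

-- The surplus zs carries both counting arguments: it can only add to the length, and equal lengths
-- make it empty, which reverses the inclusion.
unique⊆⇒complement : ∀ {A : Set} {xs ys : List A} → Unique xs → (∀ {x} → x ∈ xs → x ∈ ys) → Σ (List A) λ zs → ys ↭ xs ++ zs
unique⊆⇒complement {ys = ys} [] s = ys , ↭-refl
unique⊆⇒complement {xs = x ∷ xs} (x∉xs ∷ u) s with ∈P.∈-∃++ (s (here refl))
... | as , bs , refl with unique⊆⇒complement u s'
  where
    s' : ∀ {y} → y ∈ xs → y ∈ as ++ bs
    s' y∈ with ↭P.∈-resp-↭ (↭P.shift x as bs) (s (there y∈))
    ... | here refl = contradiction refl (All.lookup x∉xs y∈)
    ... | there p   = p
... | zs , p = zs , ↭-trans (↭P.shift x as bs) (prep x p)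

module _ {A : Set} {xs ys : List A} (u : Unique xs) (s : ∀ {x} → x ∈ xs → x ∈ ys) where
  unique⊆⇒length≤ : length xs ≤ length ys
  unique⊆⇒length≤ with unique⊆⇒complement u s
  ... | zs , p = subst (length xs ≤_) (sym (trans (↭P.↭-length p) (LP.length-++ xs))) (ℕP.m≤m+n _ _)

  unique⊆∧length≥⇒⊇ : length ys ≤ length xs → ∀ {y} → y ∈ ys → y ∈ xs
  unique⊆∧length≥⇒⊇ h with unique⊆⇒complement u s
  ... | [] , p = λ y∈ → subst (_ ∈_) (LP.++-identityʳ xs) (↭P.∈-resp-↭ p y∈)
  ... | z ∷ zs , p = contradiction h (ℕP.<⇒≱ (subst (length xs <_) (sym (trans (↭P.↭-length p) (LP.length-++ xs)))
    (ℕP.m<m+n (length xs) (s≤s z≤n))))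

module _ {N N'} (σ : Fin N ↔ Fin N') (C : LinearCode N) (C' : LinearCode N')
         (s : ∀ {x} → x ∈C C → permuteV σ x ∈C C') where

  private
    σC = L.map (permuteV σ) (codewords C)

    σC-unique : Unique σC
    σC-unique = Uniq.map⁺ (permuteV-injective σ) (codewords-unique C)

    σC⊆C' : ∀ {y} → y ∈ σC → y ∈ codewords C'
    σC⊆C' p with ∈P.∈-map⁻ (permuteV σ) p
    ... | x , q , refl = ∈-codewords⁺ C' (s (∈-codewords⁻ C q))

    ∣σC∣ : length σC ≡ ∣ C ∣C
    ∣σC∣ = LP.length-map (permuteV σ) (codewords C)

  permuted⊆⇒∣∣≤ : ∣ C ∣C ≤ ∣ C' ∣C
  permuted⊆⇒∣∣≤ = subst (_≤ ∣ C' ∣C) ∣σC∣ (unique⊆⇒length≤ σC-unique σC⊆C')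

  -- An injection into a finite set that is no larger is onto; this stands in for a comparison of
  -- dimensions.
  permuted⊆∧∣∣≥⇒⊇ : ∣ C' ∣C ≤ ∣ C ∣C → ∀ {y} → y ∈C C' → Σ (Vec Bool N) λ x → x ∈C C × y ≡ permuteV σ x
  permuted⊆∧∣∣≥⇒⊇ h {y} p with ∈P.∈-map⁻ (permuteV σ)
    (unique⊆∧length≥⇒⊇ σC-unique σC⊆C' (subst (∣ C' ∣C ≤_) (sym ∣σC∣) h) (∈-codewords⁺ C' p))
  ... | x , q , eq = x , ∈-codewords⁻ C q , eq

-- Polynomials

infix 4 _≐_
_≐_ : ∀ {m} → Monomial m → Monomial m → Set
e ≐ e' = ∀ v → e v ≡ e' v

≐-sym : ∀ {m} {e e' : Monomial m} → e ≐ e' → e' ≐ e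
≐-sym h v = sym (h v)

≐-trans : ∀ {m} {e e' e″ : Monomial m} → e ≐ e' → e' ≐ e″ → e ≐ e″
≐-trans h h' v = trans (h v) (h' v)

all-true⁻ : ∀ {A : Set} (P : A → Bool) {xs} → L.foldr _∧_ true (L.map P xs) ≡ true → ∀ {x} → x ∈ xs → P x ≡ true
all-true⁻ P {x ∷ xs} h (here refl) with P x
... | true = refl
all-true⁻ P {x ∷ xs} h (there p) with P x
... | true = all-true⁻ P h p

all-true⁺ : ∀ {A : Set} (P : A → Bool) → (∀ x → P x ≡ true) → ∀ xs → L.foldr _∧_ true (L.map P xs) ≡ true
all-true⁺ P h []       = refl
all-true⁺ P h (x ∷ xs) = cong₂ _∧_ (h x) (all-true⁺ P h xs)

eqMon⁻ : ∀ {m} {e e' : Monomial m} → eqMon e e' ≡ true → e ≐ e'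
eqMon⁻ {e = e} {e'} h v = ℕP.≡ᵇ⇒≡ (e v) (e' v) (≡⇒T (all-true⁻ (λ v → e v ≡ᵇ e' v) h (∈-allVecs v)))

eqMon⁺ : ∀ {m} {e e' : Monomial m} → e ≐ e' → eqMon e e' ≡ true
eqMon⁺ {m} {e} {e'} h = all-true⁺ _ (λ v → T⇒≡ (ℕP.≡⇒≡ᵇ (e v) (e' v) (h v))) (allVecs m)

eqMon-cong : ∀ {m} {d e d' e' : Monomial m} → (d ≐ e → d' ≐ e') → (d' ≐ e' → d ≐ e) → eqMon d e ≡ eqMon d' e'
eqMon-cong {d = d} {e} {d'} {e'} f g = true-ext
  (λ h → eqMon⁺ {e = d'} {e'} (f (eqMon⁻ {e = d} {e} h)))
  (λ h → eqMon⁺ {e = d} {e} (g (eqMon⁻ {e = d'} {e'} h)))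

coeff-cong : ∀ {m} (p : Poly m) {e e' : Monomial m} → e ≐ e' → coeff p e ≡ coeff p e'
coeff-cong []            h = refl
coeff-cong ((c , d) ∷ p) {e} {e'} h = cong₂ (λ b x → (if b then c else 0ℚ) ℚ.+ x)
  (eqMon-cong {d = d} {e} {d} {e'} (λ k → ≐-trans k h) (λ k → ≐-trans k (≐-sym h))) (coeff-cong p h)

coeff-++ : ∀ {m} (p q : Poly m) e → coeff (p ++ q) e ≡ coeff p e ℚ.+ coeff q e
coeff-++ []            q e = sym (ℚP.+-identityˡ _)
coeff-++ ((c , d) ∷ p) q e = trans (cong (c' ℚ.+_) (coeff-++ p q e)) (sym (ℚP.+-assoc c' (coeff p e) (coeff q e)))
  where c' = if eqMon d e then c else 0ℚ

coeff-scale : ∀ {m} k (p : Poly m) e → coeff (scale k p) e ≡ k ℚ.* coeff p e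
coeff-scale k []            e = sym (ℚP.*-zeroʳ k)
coeff-scale k ((c , d) ∷ p) e with eqMon d e
... | true  = trans (cong (k ℚ.* c ℚ.+_) (coeff-scale k p e)) (sym (ℚP.*-distribˡ-+ k c (coeff p e)))
... | false = trans (cong (0ℚ ℚ.+_) (coeff-scale k p e)) (trans (cong (ℚ._+ k ℚ.* coeff p e) (sym (ℚP.*-zeroʳ k)))
  (sym (ℚP.*-distribˡ-+ k 0ℚ (coeff p e))))

coeff≢0⇒term : ∀ {m} (p : Poly m) e → coeff p e ≢ 0ℚ → Any (λ x → proj₂ x ≐ e) p
coeff≢0⇒term []            e h = contradiction refl h
coeff≢0⇒term ((c , d) ∷ p) e h with eqMon d e in eq
... | true  = here (eqMon⁻ {e = d} {e} eq)
... | false = there (coeff≢0⇒term p e (λ z → h (trans (ℚP.+-identityˡ _) z)))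

-- Action of the generators on coefficients

signed : Bool → ℚ → ℚ
signed s x = if s then ℚ.- x else x

signed-+ : ∀ s x y → signed s x ℚ.+ signed s y ≡ signed s (x ℚ.+ y)
signed-+ true  x y = sym (ℚP.neg-distrib-+ x y)
signed-+ false x y = refl

signed-if : ∀ b {s s'} k → (b ≡ true → s ≡ s') → (if b then signed s k else 0ℚ) ≡ signed s' (if b then k else 0ℚ)
signed-if true             k h = cong (λ s → signed s k) (h refl)
signed-if false {s' = true}  k h = refl
signed-if false {s' = false} k h = refl

coeff-sign : ∀ {m} c a (p : Poly m) e → coeff (actGen (sign c a) p) e ≡ signed (signChar c a e) (coeff p e)
coeff-sign c a [] e with signChar c a e
... | true  = refl
... | false = refl
coeff-sign c a ((k , d) ∷ p) e = trans
  (cong₂ ℚ._+_ (signed-if (eqMon d e) k (λ h → signChar-cong c a (eqMon⁻ {e = d} {e} h))) (coeff-sign c a p e))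
  (signed-+ (signChar c a e) (if eqMon d e then k else 0ℚ) (coeff p e))

record Affine (m : ℕ) : Set where
  constructor mkAffine
  field
    A B : Mat m
    b   : Vec Bool m
    AB  : ∀ v → matVec A (matVec B v) ≡ v
    BA  : ∀ v → matVec B (matVec A v) ≡ v

  to from : Vec Bool m → Vec Bool m
  to v   = matVec A v ⊕ b
  from w = matVec B (w ⊕ b)

  to-from : ∀ w → to (from w) ≡ w
  to-from w = trans (cong (_⊕ b) (AB (w ⊕ b))) (⊕-cancelʳ w b)

  from-to : ∀ v → from (to v) ≡ v
  from-to v = trans (cong (matVec B) (⊕-cancelʳ (matVec A v) b)) (BA v)

  generator : Gen m
  generator = affine A B b AB BA

coeff-affine : ∀ {m} (g : Affine m) (p : Poly m) e → coeff (actGen (Affine.generator g) p) e ≡ coeff p (e ∘ Affine.to g)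
coeff-affine g []            e = refl
coeff-affine g ((c , d) ∷ p) e = cong₂ (λ x y → (if x then c else 0ℚ) ℚ.+ y)
  (eqMon-cong {d = d ∘ from} {e} {d} {e ∘ to}
    (λ h v → trans (cong d (sym (from-to v))) (h (to v)))
    (λ h w → trans (h (from w)) (cong e (to-from w))))
  (coeff-affine g p e)
  where open Affine g

-- Invariance read off coefficient by coefficient. A sign generator multiplies the coefficient at
-- `e` by 1 or -1, so it forces zero where the sign is -1; an affine generator moves coefficients
-- along orbits of monomials.
record Symmetric {m} (p : Poly m) : Set where
  field
    sign-vanish      : ∀ c a e → signChar c a e ≡ true → coeff p e ≡ 0ℚ
    affine-invariant : ∀ g e → coeff p (e ∘ Affine.to g) ≡ coeff p e
open Symmetric

neg≡self⇒0 : ∀ x → ℚ.- x ≡ x → x ≡ 0ℚ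
neg≡self⇒0 x h with ℚP.<-cmp x 0ℚ
... | tri≈ _ eq _ = eq
... | tri< x<0 _ _ = contradiction (ℚP.<-trans x<0 (subst (0ℚ ℚ.<_) h (ℚP.neg-antimono-< x<0))) (ℚP.<-irrefl refl)
... | tri> _ _ x>0 = contradiction (ℚP.<-trans x>0 (subst (ℚ._< 0ℚ) h (ℚP.neg-antimono-< x>0))) (ℚP.<-irrefl refl)

invariant⇒symmetric : ∀ {m} {p : Poly m} → Invariant m p → Symmetric p
invariant⇒symmetric {p = p} inv .sign-vanish c a e χ = neg≡self⇒0 _
  (trans (sym (cong (λ s → signed s (coeff p e)) χ)) (trans (sym (coeff-sign c a p e)) (inv (sign c a ∷ []) e)))
invariant⇒symmetric {p = p} inv .affine-invariant g e =
  trans (sym (coeff-affine g p e)) (inv (Affine.generator g ∷ []) e)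

symmetric⇒invariant : ∀ {m} {p : Poly m} → Symmetric p → Invariant m p
symmetric⇒invariant         S []                        e = refl
symmetric⇒invariant {p = p} S (sign c a ∷ w)            e = begin
  coeff (actGen (sign c a) (act w p)) e ≡⟨ coeff-sign c a (act w p) e ⟩
  signed (signChar c a e) (coeff (act w p) e)
    ≡⟨ cong (signed (signChar c a e)) (symmetric⇒invariant S w e) ⟩
  signed (signChar c a e) (coeff p e) ≡⟨ fixed ⟩
  coeff p e ∎
  where
    fixed : signed (signChar c a e) (coeff p e) ≡ coeff p e
    fixed with signChar c a e in eq
    ... | false = refl
    ... | true  = trans (cong ℚ.-_ (sign-vanish S c a e eq)) (sym (sign-vanish S c a e eq))
symmetric⇒invariant {p = p} S (affine A B b AB BA ∷ w) e =
  trans (coeff-affine g (act w p) e) (trans (symmetric⇒invariant S w _) (affine-invariant S g e))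
  where g = mkAffine A B b AB BA

symmetric-++ : ∀ {m} {p q : Poly m} → Symmetric p → Symmetric q → Symmetric (p ++ q)
symmetric-++ {p = p} {q} S R .sign-vanish c a e χ = trans (coeff-++ p q e) (cong₂ ℚ._+_ (sign-vanish S c a e χ) (sign-vanish R c a e χ))
symmetric-++ {p = p} {q} S R .affine-invariant g e = trans (coeff-++ p q _)
  (trans (cong₂ ℚ._+_ (affine-invariant S g e) (affine-invariant R g e)) (sym (coeff-++ p q e)))

symmetric-scale : ∀ {m} {p : Poly m} k → Symmetric p → Symmetric (scale k p)
symmetric-scale {p = p} k S .sign-vanish c a e χ = trans (coeff-scale k p e) (trans (cong (k ℚ.*_) (sign-vanish S c a e χ)) (ℚP.*-zeroʳ k))
symmetric-scale {p = p} k S .affine-invariant g e = trans (coeff-scale k p _)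
  (trans (cong (k ℚ.*_) (affine-invariant S g e)) (sym (coeff-scale k p e)))

-- Complete weight enumerators

∈-tuples⁺ : ∀ {A : Set} {m} {xs : List A} (t : Vec A m) → (∀ i → lookup t i ∈ xs) → t ∈ tuples m xs
∈-tuples⁺ []      h = here refl
∈-tuples⁺ (x ∷ t) h = ∈P.∈-concatMap⁺ _ (Any.map (λ { refl → ∈P.∈-map⁺ (x ∷_) (∈-tuples⁺ t (h ∘ suc)) }) (h zero))

tuples-suc : ∀ {A : Set} m (xs ys : List A) → concatMap (λ x → L.map (x ∷_) (tuples m xs)) ys ≡ L.cartesianProductWith _∷_ ys (tuples m xs)
tuples-suc m xs []       = refl
tuples-suc m xs (y ∷ ys) = cong (L.map (y ∷_) (tuples m xs) ++_) (tuples-suc m xs ys)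

tuples-unique : ∀ {A : Set} m {xs : List A} → Unique xs → Unique (tuples m xs)
tuples-unique zero         u = [] ∷ []
tuples-unique (suc m) {xs} u = subst Unique (sym (tuples-suc m xs xs))
  (Uniq.cartesianProductWith⁺ _∷_ VP.∷-injective u (tuples-unique m u))

∈-tuples⁻ : ∀ {A : Set} {m} {xs : List A} {t : Vec A m} → t ∈ tuples m xs → ∀ i → lookup t i ∈ xs
∈-tuples⁻ {m = suc m} {xs} {t} p i with ∈P.∈-cartesianProductWith⁻ _∷_ xs (tuples m xs) (subst (t ∈_) (tuples-suc m xs xs) p)
∈-tuples⁻ {m = suc m} p zero    | x , s , x∈ , s∈ , refl = x∈
∈-tuples⁻ {m = suc m} p (suc i) | x , s , x∈ , s∈ , refl = ∈-tuples⁻ s∈ i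

monomialSum : ∀ {m N} → List (Vec (Vec Bool N) m) → Poly m
monomialSum = L.map (λ t → (1ℚ , cweMonomial t))

indicator : Bool → ℚ
indicator b = if b then 1ℚ else 0ℚ

monomialSum-↭ : ∀ {m N} {ts us : List (Vec (Vec Bool N) m)} → ts ↭ us → ∀ e → coeff (monomialSum ts) e ≡ coeff (monomialSum us) e
monomialSum-↭ ↭.refl          e = refl
monomialSum-↭ (↭.prep t p)    e = cong (indicator (eqMon (cweMonomial t) e) ℚ.+_) (monomialSum-↭ p e)
monomialSum-↭ {ts = _ ∷ _ ∷ ts} {_ ∷ _ ∷ us} (↭.swap t u p)  e = begin
  i ℚ.+ (j ℚ.+ coeff (monomialSum ts) e) ≡⟨ cong (λ x → i ℚ.+ (j ℚ.+ x)) (monomialSum-↭ p e) ⟩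
  i ℚ.+ (j ℚ.+ r)                       ≡⟨ sym (ℚP.+-assoc i j r) ⟩
  (i ℚ.+ j) ℚ.+ r                       ≡⟨ cong (ℚ._+ r) (ℚP.+-comm i j) ⟩
  (j ℚ.+ i) ℚ.+ r                       ≡⟨ ℚP.+-assoc j i r ⟩
  j ℚ.+ (i ℚ.+ r)                       ∎
  where
    i = indicator (eqMon (cweMonomial t) e)
    j = indicator (eqMon (cweMonomial u) e)
    r = coeff (monomialSum us) e
monomialSum-↭ (↭.trans p q)   e = trans (monomialSum-↭ p e) (monomialSum-↭ q e)

monomialSum-map : ∀ {m N} (θ : Vec (Vec Bool N) m → Vec (Vec Bool N) m) {e e' : Monomial m} →
  (∀ t → cweMonomial t ≐ e' → cweMonomial (θ t) ≐ e) → (∀ t → cweMonomial (θ t) ≐ e → cweMonomial t ≐ e') →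
  ∀ ts → coeff (monomialSum ts) e' ≡ coeff (monomialSum (L.map θ ts)) e
monomialSum-map θ f g []       = refl
monomialSum-map θ {e} {e'} f g (t ∷ ts) = cong₂ (λ b x → indicator b ℚ.+ x) (eqMon-cong {d = cweMonomial t} {e'} {cweMonomial (θ t)} {e} (f t) (g t)) (monomialSum-map θ f g ts)

indicator-nonneg : ∀ b → 0ℚ ℚ.≤ indicator b
indicator-nonneg true  = ℚP.nonNegative⁻¹ 1ℚ
indicator-nonneg false = ℚP.≤-refl

monomialSum-nonneg : ∀ {m N} (ts : List (Vec (Vec Bool N) m)) e → 0ℚ ℚ.≤ coeff (monomialSum ts) e
monomialSum-nonneg []       e = ℚP.≤-refl
monomialSum-nonneg (t ∷ ts) e = ℚP.+-mono-≤ (indicator-nonneg (eqMon (cweMonomial t) e)) (monomialSum-nonneg ts e)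

monomialSum-positive : ∀ {m N} {ts : List (Vec (Vec Bool N) m)} {t} e → t ∈ ts → cweMonomial t ≐ e → 0ℚ ℚ.< coeff (monomialSum ts) e
monomialSum-positive {ts = t ∷ ts} e (here refl) h = ℚP.+-mono-<-≤
  (subst (λ b → 0ℚ ℚ.< indicator b) (sym (eqMon⁺ {e = cweMonomial t} {e} h)) (ℚP.positive⁻¹ 1ℚ)) (monomialSum-nonneg ts e)
monomialSum-positive {ts = t ∷ ts} e (there p)   h = ℚP.+-mono-≤-<
  (indicator-nonneg (eqMon (cweMonomial t) e)) (monomialSum-positive e p h)

-- Every tuple contributes 1, so nothing cancels. These coefficients are the pivots for spanning and
-- for independence.
cwe-positive : ∀ {m N} (C : LinearCode N) {t : Vec (Vec Bool N) m} → (∀ i → lookup t i ∈C C) → ∀ {e} → cweMonomial t ≐ e → coeff (cwe m C) e ≢ 0ℚ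
cwe-positive C {t} h {e} eq z = ℚP.<-irrefl (sym z) (monomialSum-positive e (∈-tuples⁺ t (∈-codewords⁺ C ∘ h)) eq)

cwe-term : ∀ {m N} (C : LinearCode N) e → coeff (cwe m C) e ≢ 0ℚ →
  Σ (Vec (Vec Bool N) m) λ t → (∀ i → lookup t i ∈C C) × cweMonomial t ≐ e
cwe-term {m} C e h with find (coeff≢0⇒term (cwe m C) e h)
... | x , x∈ , eq with ∈P.∈-map⁻ (λ t → (1ℚ , cweMonomial t)) x∈
... | t , t∈ , refl = t , (λ i → ∈-codewords⁻ C (∈-tuples⁻ t∈ i)) , eq

cweMonomial-affine : ∀ {m N} (t u : Vec (Vec Bool N) m) (g : Affine m) → (∀ j → col u j ≡ Affine.to g (col t j)) →
  cweMonomial u ∘ Affine.to g ≐ cweMonomial t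
cweMonomial-affine t u g h v = trans (cweMonomial-count u (to v)) (trans
  (count-cong (λ j → true-ext (fwd j) (bwd j))) (sym (cweMonomial-count t v)))
  where
    open Affine g
    fwd : ∀ j → eqV (col u j) (to v) ≡ true → eqV (col t j) v ≡ true
    fwd j p = subst (λ x → eqV (col t j) x ≡ true)
      (trans (sym (from-to (col t j))) (trans (cong from (trans (sym (h j)) (eqV⇒≡ (col u j) (to v) p))) (from-to v))) (eqV-refl (col t j))
    bwd : ∀ j → eqV (col t j) v ≡ true → eqV (col u j) (to v) ≡ true
    bwd j p = subst (λ x → eqV (col u j) x ≡ true) (trans (h j) (cong to (eqV⇒≡ (col t j) v p))) (eqV-refl (col u j))

shiftTuple : ∀ {m N} → Vec Bool m → Vec (Vec Bool N) m → Vec (Vec Bool N) m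
shiftTuple = zipWith (λ a x → x ⊕ (if a then 𝟏 else 𝟎))

col-shiftTuple : ∀ {m N} (b : Vec Bool m) (t : Vec (Vec Bool N) m) j → col (shiftTuple b t) j ≡ col t j ⊕ b
col-shiftTuple []      []      j = refl
col-shiftTuple (a ∷ b) (x ∷ t) j = cong₂ _∷_
  (trans (lookup-zipWith _xor_ j x _) (cong (lookup x j xor_) (constant a))) (col-shiftTuple b t j)
  where
    constant : ∀ a → lookup (if a then 𝟏 else 𝟎) j ≡ a
    constant true  = lookup-replicate j true
    constant false = lookup-replicate j false

matrixTuple : ∀ {m N} → Mat m → Vec (Vec Bool N) m → Vec (Vec Bool N) m
matrixTuple A t = tabulate (λ i → combo (tabulate (A i)) t)

col-matrixTuple : ∀ {m N} (A : Mat m) (t : Vec (Vec Bool N) m) j → col (matrixTuple A t) j ≡ matVec A (col t j)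
col-matrixTuple A t j = lookup-ext λ i → begin
  lookup (col (matrixTuple A t) j) i                ≡⟨ lookup-col (matrixTuple A t) j i ⟩
  lookup (lookup (matrixTuple A t) i) j             ≡⟨ cong (λ x → lookup x j) (lookup∘tabulate _ i) ⟩
  lookup (combo (tabulate (A i)) t) j               ≡⟨ lookup-combo (tabulate (A i)) t j ⟩
  dot (tabulate (A i)) (col t j)                    ≡⟨ dot-⨁ (tabulate (A i)) (col t j) ⟩
  ⨁ (λ k → lookup (tabulate (A i)) k ∧ lookup (col t j) k)
    ≡⟨ ⨁-cong (λ k → cong (_∧ lookup (col t j) k) (lookup∘tabulate (A i) k)) ⟩
  ⨁ (λ k → A i k ∧ lookup (col t j) k)              ≡⟨ sym (matVec-⨁ A (col t j) i) ⟩
  lookup (matVec A (col t j)) i                     ∎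

code-subspace : ∀ {N} (C : LinearCode N) → Subspace (_∈C C)
code-subspace C .has-𝟎 = mem-zero C
code-subspace C .closed = mem-add C _ _
code-subspace C .dec x = mem C x 𝔹.≟ true

combo-∈ : ∀ {N k} (C : LinearCode N) (ls : Vec Bool k) (t : Vec (Vec Bool N) k) → (∀ i → lookup t i ∈C C) → combo ls t ∈C C
combo-∈ C []           []      h = mem-zero C
combo-∈ C (true ∷ ls)  (x ∷ t) h = mem-add C x _ (h zero) (combo-∈ C ls t (h ∘ suc))
combo-∈ C (false ∷ ls) (x ∷ t) h = mem-add C 𝟎 _ (mem-zero C) (combo-∈ C ls t (h ∘ suc))

matrixTuple-∈ : ∀ {m N} (C : LinearCode N) (A : Mat m) (t : Vec (Vec Bool N) m) → (∀ i → lookup t i ∈C C) → ∀ i → lookup (matrixTuple A t) i ∈C C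
matrixTuple-∈ C A t h i = subst (_∈C C) (sym (lookup∘tabulate _ i)) (combo-∈ C (tabulate (A i)) t h)

shiftTuple-∈ : ∀ {m N} (C : LinearCode N) → ContainsOnes C → (b : Vec Bool m) (t : Vec (Vec Bool N) m) →
  (∀ i → lookup t i ∈C C) → ∀ i → lookup (shiftTuple b t) i ∈C C
shiftTuple-∈ C ones (true ∷ b)  (x ∷ t) h zero    = mem-add C x 𝟏 (h zero) ones
shiftTuple-∈ C ones (false ∷ b) (x ∷ t) h zero    = mem-add C x 𝟎 (h zero) (mem-zero C)
shiftTuple-∈ C ones (_ ∷ b)     (x ∷ t) h (suc i) = shiftTuple-∈ C ones b t (h ∘ suc) i

module _ {m N} (C : LinearCode N) (ones : ContainsOnes C) (g : Affine m) where
  open Affine g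

  private
    θ θ⁻¹ : Vec (Vec Bool N) m → Vec (Vec Bool N) m
    θ t   = shiftTuple b (matrixTuple A t)
    θ⁻¹ u = matrixTuple B (shiftTuple b u)

    col-θ : ∀ t j → col (θ t) j ≡ to (col t j)
    col-θ t j = trans (col-shiftTuple b (matrixTuple A t) j) (cong (_⊕ b) (col-matrixTuple A t j))

    col-θ⁻¹ : ∀ u j → col (θ⁻¹ u) j ≡ from (col u j)
    col-θ⁻¹ u j = trans (col-matrixTuple B (shiftTuple b u) j) (cong (matVec B) (col-shiftTuple b u j))

    θ⁻¹-θ : ∀ t → θ⁻¹ (θ t) ≡ t
    θ⁻¹-θ t = col-ext λ j → trans (col-θ⁻¹ (θ t) j) (trans (cong from (col-θ t j)) (from-to (col t j)))

    ts = tuples m (codewords C)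

    -- `θ` maps a finite list without repetitions injectively into itself, hence onto: comparing
    -- lengths leaves no surplus.
    tuples-↭ : ts ↭ L.map θ ts
    tuples-↭ with unique⊆⇒complement (Uniq.map⁺ θ-injective (tuples-unique m (codewords-unique C))) image⊆
      where
        θ-injective : ∀ {t u} → θ t ≡ θ u → t ≡ u
        θ-injective {t} {u} eq = trans (sym (θ⁻¹-θ t)) (trans (cong θ⁻¹ eq) (θ⁻¹-θ u))
        image⊆ : ∀ {u} → u ∈ L.map θ ts → u ∈ ts
        image⊆ p with ∈P.∈-map⁻ θ p
        ... | t , t∈ , refl = ∈-tuples⁺ (θ t) (∈-codewords⁺ C ∘ shiftTuple-∈ C ones b _ (matrixTuple-∈ C A t (∈-codewords⁻ C ∘ ∈-tuples⁻ t∈)))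
    ... | [] , p = subst (ts ↭_) (LP.++-identityʳ _) p
    ... | z ∷ zs , p = contradiction (trans (↭P.↭-length p) (trans (LP.length-++ (L.map θ ts)) (cong (_+ suc (length zs)) (LP.length-map θ ts))))
      (ℕP.<⇒≢ (ℕP.m<m+n (length ts) (s≤s z≤n)))

  -- The code is closed under linear combinations and under adding `𝟏`, so an affine map of the
  -- columns only permutes the tuples summed over.
  cwe-affine : ∀ e → coeff (cwe m C) (e ∘ to) ≡ coeff (cwe m C) e
  cwe-affine e = trans (monomialSum-map θ
    (λ t h w → trans (cong (cweMonomial (θ t)) (sym (to-from w)))
      (trans (cweMonomial-affine t (θ t) g (col-θ t) (from w)) (trans (h (from w)) (cong e (to-from w)))))
    (λ t h v → trans (sym (cweMonomial-affine t (θ t) g (col-θ t) v)) (h (to v))) ts)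
    (sym (monomialSum-↭ tuples-↭ e))

∧∧-zero : ∀ x y {z} → z ≡ false → x ∧ y ∧ z ≡ false
∧∧-zero x y refl = trans (cong (x ∧_) (∧-zeroʳ y)) (∧-zeroʳ x)

-- As for the signs, a monomial that occurs comes from a tuple of codewords, whose Gram matrix
-- vanishes, and N is even because `𝟏` is orthogonal to itself.
cwe-symmetric : ∀ {m N} (C : LinearCode N) → SelfOrthogonal C → ContainsOnes C → Symmetric (cwe m C)
cwe-symmetric {m} {N} C orth ones .affine-invariant = cwe-affine C ones
cwe-symmetric {m} {N} C orth ones .sign-vanish c a e χ with coeff (cwe m C) e ℚP.≟ 0ℚ
... | yes z = z
... | no nz with cwe-term C e nz
... | t , t∈ , eq with () ← begin
  true                          ≡⟨ sym χ ⟩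
  signChar c a e                ≡⟨ signChar-cong c a (≐-sym eq) ⟩
  signChar c a (cweMonomial t)  ≡⟨ signChar-cweMonomial c a t ⟩
  gramForm c a t                ≡⟨ cong₂ _xor_
    (⨁-false (λ i → ⨁-false (λ k → ∧∧-zero ⌊ i F.≤? k ⌋ (c i k) (orth _ (t∈ i) _ (t∈ k)))))
    (trans (cong (a ∧_) (orth 𝟏 ones 𝟏 ones)) (∧-zeroʳ a)) ⟩
  false                         ∎

-- Codes spanned by a tuple and the all-ones vector

Span-subspace : ∀ {N n} {W : Subset N} → Subspace W → (t : Vec (Vec Bool N) n) → Subspace (Span W t)
Span-subspace S []      = S
Span-subspace S (y ∷ t) = Span-subspace (+⟨⟩-subspace S y) t

Span-combo⁻ : ∀ {N n} {W : Subset N} (t : Vec (Vec Bool N) n) {x} → Span W t x →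
  Σ (Vec Bool n) λ ls → Σ (Vec Bool N) λ w → W w × w ⊕ combo ls t ≡ x
Span-combo⁻ []      {x} p = [] , x , p , ⊕-identityʳ x
Span-combo⁻ (y ∷ t) p with Span-combo⁻ t p
... | ls , w , inj₁ q , eq = false ∷ ls , w , q , trans (cong (w ⊕_) (⊕-identityˡ _)) eq
... | ls , w , inj₂ q , eq = true ∷ ls , w ⊕ y , q ,
  trans (sym (⊕-assoc (w ⊕ y) y _)) (trans (cong (_⊕ combo ls t) (⊕-cancelʳ w y)) eq)

Span-𝟎𝟏-least : ∀ {N n} {X : Subset N} → Subspace X → X 𝟏 → (t : Vec (Vec Bool N) n) → (∀ i → X (lookup t i)) → Span 𝟎𝟏 t ⊆ X
Span-𝟎𝟏-least S ones t h = Span-least {W = 𝟎𝟏} t S (+⟨⟩-least {W = λ x → x ≡ 𝟎} S (λ { refl → has-𝟎 S }) ones) h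

Span-𝟏 : ∀ {N n} (t : Vec (Vec Bool N) n) → Span 𝟎𝟏 t 𝟏
Span-𝟏 t = Span-base t (+⟨⟩-self 𝟎-subspace 𝟏)

-- This is D(t). Decidability of the span provides the Boolean membership test.
spanCode : ∀ {N n} → Vec (Vec Bool N) n → LinearCode N
spanCode t = record
  { mem      = λ x → ⌊ dec S x ⌋
  ; mem-zero = T⇒≡ (fromWitness (has-𝟎 S))
  ; mem-add  = λ x y p q → T⇒≡ (fromWitness (closed S (toWitness (≡⇒T p)) (toWitness (≡⇒T q))))
  }
  where S = Span-subspace 𝟎𝟏-subspace t

∈-spanCode⁺ : ∀ {N n} (t : Vec (Vec Bool N) n) {x} → Span 𝟎𝟏 t x → x ∈C spanCode t
∈-spanCode⁺ t p = T⇒≡ (fromWitness p)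

∈-spanCode⁻ : ∀ {N n} (t : Vec (Vec Bool N) n) {x} → x ∈C spanCode t → Span 𝟎𝟏 t x
∈-spanCode⁻ t p = toWitness (≡⇒T p)

lookup-∈-spanCode : ∀ {N n} (t : Vec (Vec Bool N) n) i → lookup t i ∈C spanCode t
lookup-∈-spanCode t i = ∈-spanCode⁺ t (Span-lookup 𝟎𝟏-subspace t i)

⊥-subspace : ∀ {N} (y : Vec Bool N) → Subspace (λ x → dot y x ≡ false)
⊥-subspace y .has-𝟎 = dot-𝟎ʳ y
⊥-subspace y .closed {u} {v} p q = trans (dot-⊕ʳ y u v) (cong₂ _xor_ p q)
⊥-subspace y .dec x = dot y x 𝔹.≟ false

-- Linearity is used once in each argument: first against a fixed generator, then against a fixed
-- codeword. Products of rows with `𝟏` reduce to products of a row with itself.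
spanCode-selfOrthogonal : ∀ {N n} (t : Vec (Vec Bool N) n) → dot 𝟏 (𝟏 {N}) ≡ false →
  (∀ i k → dot (lookup t i) (lookup t k) ≡ false) → SelfOrthogonal (spanCode t)
spanCode-selfOrthogonal {N} t even orth x x∈ y y∈ = Span-𝟎𝟏-least (⊥-subspace x)
  (trans (dot-comm x 𝟏) (⊥-of 𝟏 even (λ k → trans (dot-𝟏ˡ (lookup t k)) (orth k k)) x∈))
  t (λ i → trans (dot-comm x (lookup t i)) (⊥-of (lookup t i) (trans (dot-comm (lookup t i) 𝟏) (trans (dot-𝟏ˡ (lookup t i)) (orth i i))) (orth i) x∈))
  (∈-spanCode⁻ t y∈)
  where
    ⊥-of : ∀ z → dot z 𝟏 ≡ false → (∀ k → dot z (lookup t k) ≡ false) → ∀ {x} → x ∈C spanCode t → dot z x ≡ false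
    ⊥-of z p q x∈ = Span-𝟎𝟏-least (⊥-subspace z) p t q (∈-spanCode⁻ t x∈)

spanCode-dim : ∀ {N m} (t : Vec (Vec Bool N) m) → DimAtMost (suc m) (spanCode t)
-- `Span 𝟎𝟏 t` unfolds to the span of `𝟏 ∷ t` over the zero space, whence m + 1 generators.
spanCode-dim {m = m} t = suc m , ℕP.≤-refl , 𝟏 ∷ t , generate , member
  where
    generate : ∀ x → x ∈C spanCode t → Σ (Vec Bool (suc m)) λ ls → combo ls (𝟏 ∷ t) ≡ x
    generate x p with Span-combo⁻ (𝟏 ∷ t) (∈-spanCode⁻ t p)
    ... | ls , w , refl , eq = ls , trans (sym (⊕-identityˡ _)) eq
    member : ∀ ls → combo ls (𝟏 ∷ t) ∈C spanCode t
    member ls = ∈-spanCode⁺ t (subst (Span 𝟎𝟏 t) (⊕-identityˡ _) (Span-combo 𝟎-subspace refl ls (𝟏 ∷ t)))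

signs-fix⇒admissible : ∀ {m N} (t : Vec (Vec Bool N) m) → (∀ c a → signChar c a (cweMonomial t) ≡ false) → Admissible m (spanCode t)
signs-fix⇒admissible t h =
  spanCode-selfOrthogonal t (signs-fix⇒even t h) (signs-fix⇒orthogonal t h) , ∈-spanCode⁺ t (Span-𝟏 t) , spanCode-dim t

record _Generates_ {N n} (t : Vec (Vec Bool N) n) (C : LinearCode N) : Set where
  field
    ⊆C : ∀ i → lookup t i ∈C C
    C⊆ : ∀ {x} → x ∈C C → Span 𝟎𝟏 t x
open _Generates_

spanCode-generated : ∀ {N n} (t : Vec (Vec Bool N) n) → t Generates spanCode t
spanCode-generated t .⊆C = lookup-∈-spanCode t
spanCode-generated t .C⊆ = ∈-spanCode⁻ t

generators-related : ∀ {m N} (C : LinearCode N) → ContainsOnes C → {t u : Vec (Vec Bool N) m} →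
  t Generates C → u Generates C → AffinelyRelated t u
generators-related C ones {t} {u} G H = ~⇒affine (same-span⇒~ 𝟎𝟏-subspace t u
  (C⊆ H ∘ Span-𝟎𝟏-least (code-subspace C) ones t (⊆C G))
  (C⊆ G ∘ Span-𝟎𝟏-least (code-subspace C) ones u (⊆C H)))

pad : ∀ {N k m} → k ≤ m → Vec (Vec Bool N) k → Vec (Vec Bool N) m
pad z≤n     []      = replicate _ 𝟎
pad (s≤s p) (x ∷ t) = x ∷ pad p t

lookup-pad : ∀ {N k m} {X : Subset N} (p : k ≤ m) (t : Vec (Vec Bool N) k) → X 𝟎 → (∀ i → X (lookup t i)) → ∀ i → X (lookup (pad p t) i)
lookup-pad {X = X} z≤n     []      z h i       = subst X (sym (lookup-replicate i 𝟎)) z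
lookup-pad         (s≤s p) (x ∷ t) z h zero    = h zero
lookup-pad {X = X} (s≤s p) (x ∷ t) z h (suc i) = lookup-pad {X = X} p t z (h ∘ suc) i

Span-pad : ∀ {N k m} {W : Subset N} (p : k ≤ m) (t : Vec (Vec Bool N) k) → Span W t ⊆ Span W (pad p t)
Span-pad {m = m} {W} z≤n [] q = Span-base {W = W} (replicate m 𝟎) q
Span-pad (s≤s p) (x ∷ t) q = Span-pad p t q

-- Steinitz exchange puts 𝟏 among the given m + 1 generators.
dimAtMost⇒generated : ∀ {m N} (C : LinearCode N) → ContainsOnes C → DimAtMost (suc m) C → Σ (Vec (Vec Bool N) m) (_Generates C)
-- At length 0 the vectors `𝟎` and `𝟏` coincide, so `𝟏` cannot be exchanged in; empty rows generate
-- the code.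
dimAtMost⇒generated {m} {zero} C ones dim = replicate m [] , record
  { ⊆C = λ i → subst (_∈C C) (sym (lookup-replicate i [])) (mem-zero C)
  ; C⊆ = λ { {[]} _ → Span-base (replicate m []) (inj₁ refl) } }
dimAtMost⇒generated {m} {suc N} C ones (k , k≤ , G , gen , mem) = go k≤ G
  (λ {x} p → subst (Span _ G) (trans (⊕-identityˡ _) (proj₂ (gen x p))) (Span-combo 𝟎-subspace refl (proj₁ (gen x p)) G))
  (λ p → in-C (Span-combo⁻ G p))
  where
    in-C : ∀ {x} → Σ (Vec Bool k) (λ ls → Σ (Vec Bool (suc N)) λ w → w ≡ 𝟎 × w ⊕ combo ls G ≡ x) → x ∈C C
    in-C (ls , w , refl , eq) = subst (_∈C C) (trans (sym (⊕-identityˡ _)) eq) (mem ls)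
    go : ∀ {k} → k ≤ suc m → (G : Vec (Vec Bool (suc N)) k) → (∀ {x} → x ∈C C → Span (λ x → x ≡ 𝟎) G x) →
         (∀ {x} → Span (λ x → x ≡ 𝟎) G x → x ∈C C) → Σ (Vec (Vec Bool (suc N)) m) (_Generates C)
    -- At positive length `𝟏` is nonzero: this excludes k = 0 and makes the exchange below possible.
    go z≤n [] f g with () ← f ones
    go (s≤s p) G@(_ ∷ _) f g with exchange 𝟎-subspace G (f ones) (λ ())
    ... | u , r = pad p u , record
      { ⊆C = lookup-pad {X = _∈C C} p u (mem-zero C)
          (λ i → g (Span-~ (~-sym r) id 𝟎-subspace (Span-lookup 𝟎-subspace (𝟏 ∷ u) (suc i))))
      ; C⊆ = λ x∈ → Span-pad p u (Span-~ r id 𝟎-subspace (f x∈)) }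

preimage-subspace : ∀ {N N'} (σ : Fin N ↔ Fin N') {X : Subset N'} → Subspace X → Subspace (X ∘ permuteV σ)
preimage-subspace σ {X} S .has-𝟎 = subst X (sym (permuteV-replicate σ false)) (has-𝟎 S)
preimage-subspace σ {X} S .closed {u} {v} p q = subst X (sym (permuteV-⊕ σ u v)) (closed S p q)
preimage-subspace σ S .dec x = dec S (permuteV σ x)

-- A tuple generating C shares its monomial with a tuple over C' only if a
-- coordinate permutation carries C into C'.
module SharedMonomial {m N N'} {C : LinearCode N} {t : Vec (Vec Bool N) m} (G : t Generates C)
         {C' : LinearCode N'} (ones' : ContainsOnes C') {u : Vec (Vec Bool N') m} (u∈ : ∀ i → lookup u i ∈C C')
         (h : cweMonomial t ≐ cweMonomial u) where

  private
    σ = proj₁ (same-monomial⇒permutation t u h)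

    σt≡u : ∀ i → permuteV σ (lookup t i) ≡ lookup u i
    σt≡u i = trans (sym (lookup-map i (permuteV σ) t)) (cong (λ v → lookup v i) (proj₂ (same-monomial⇒permutation t u h)))

    span-image : ∀ {X : Subset N'} → Subspace X → X 𝟏 → (∀ i → X (lookup u i)) → ∀ {x} → x ∈C C → X (permuteV σ x)
    span-image {X} S ones q x∈ = Span-𝟎𝟏-least (preimage-subspace σ S) (subst X (sym (permuteV-replicate σ true)) ones) t
      (λ i → subst X (sym (σt≡u i)) (q i)) (C⊆ G x∈)

    σC⊆C' : ∀ {x} → x ∈C C → permuteV σ x ∈C C'
    σC⊆C' = span-image (code-subspace C') ones' u∈

  size≤ : ∣ C ∣C ≤ ∣ C' ∣C
  size≤ = permuted⊆⇒∣∣≤ σ C C' σC⊆C'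

  module _ (big : ∣ C' ∣C ≤ ∣ C ∣C) where

    -- Under `big` the permutation carries C onto C', so the images of generators of C generate C'.
    generates : u Generates C'
    generates .⊆C = u∈
    generates .C⊆ y∈ with permuted⊆∧∣∣≥⇒⊇ σ C C' σC⊆C' big y∈
    ... | x , x∈ , refl = span-image (Span-subspace 𝟎𝟏-subspace u) (Span-𝟏 u) (Span-lookup 𝟎𝟏-subspace u) x∈

    equivalent : Equivalent C C'
    equivalent = σ , λ x → true-ext (back x) σC⊆C'
      where
        back : ∀ x → permuteV σ x ∈C C' → x ∈C C
        back x p with permuted⊆∧∣∣≥⇒⊇ σ C C' σC⊆C' big p
        ... | y , y∈ , eq = subst (_∈C C) (sym (permuteV-injective σ eq)) y∈

-- Spanning

-- Here the additive maps become matrices, and so an element of AGL(m,2) to which invariance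
-- applies.
related⇒same-coeff : ∀ {m N} {p : Poly m} → Symmetric p → {t u : Vec (Vec Bool N) m} → AffinelyRelated t u →
  coeff p (cweMonomial t) ≡ coeff p (cweMonomial u)
related⇒same-coeff {p = p} S {t} {u} R = trans
  (coeff-cong p (≐-sym (cweMonomial-affine t u g (λ j → trans (col-map R j) (cong (_⊕ shift R) (sym (A-φ (col t j))))))))
  (affine-invariant S g (cweMonomial u))
  where
    A-φ = matVec-matrixOf (φ-additive R)
    B-φ⁻¹ = matVec-matrixOf (φ⁻¹-additive R)
    g = mkAffine (matrixOf (φ R)) (matrixOf (φ⁻¹ R)) (shift R)
      (λ v → trans (A-φ _) (trans (cong (φ R) (B-φ⁻¹ v)) (φ-φ⁻¹ R v)))
      (λ v → trans (B-φ⁻¹ _) (trans (cong (φ⁻¹ R) (A-φ v)) (φ⁻¹-φ R v)))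

IsLinComb : ∀ {m} → Poly m → Set
IsLinComb {m} p = Σ (List (ℚ × AdmCode m)) λ L → p ≈P linComb m L

coeff-linComb-∷ : ∀ {m} k (A : AdmCode m) L e →
  coeff (linComb m ((k , A) ∷ L)) e ≡ k ℚ.* coeff (cwe m (codeOf A)) e ℚ.+ coeff (linComb m L) e
coeff-linComb-∷ {m} k A L e = trans (coeff-++ (scale k (cwe m (codeOf A))) (linComb m L) e)
  (cong (ℚ._+ coeff (linComb m L) e) (coeff-scale k (cwe m (codeOf A)) e))

coeff-zero⇒isLinComb : ∀ {m} {p : Poly m} → (∀ {N} (t : Vec (Vec Bool N) m) → coeff p (cweMonomial t) ≡ 0ℚ) → IsLinComb p
coeff-zero⇒isLinComb {p = p} h = [] , λ e → let N , t , eq = monomial-realised e in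
  trans (sym (coeff-cong p eq)) (h t)

size : ∀ {m N} → Vec (Vec Bool N) m → ℕ
size t = ∣ spanCode t ∣C

-- All words are combinations of m + 1 vectors, so there are at most 2^(m+1) of them. The bound is
-- uniform in N and starts the descent on size for all lengths at once.
codewords≤ : ∀ {m N} (t : Vec (Vec Bool N) m) → size t ≤ length (allVecs (suc m))
codewords≤ {m} t = subst (size t ≤_) (LP.length-map _ (allVecs (suc m))) (unique⊆⇒length≤ (codewords-unique (spanCode t)) image)
  where
    image : ∀ {x} → x ∈ codewords (spanCode t) → x ∈ L.map (λ ls → combo ls (𝟏 ∷ t)) (allVecs (suc m))
    image {x} p with proj₁ (proj₂ (proj₂ (proj₂ (spanCode-dim t)))) x (∈-codewords⁻ (spanCode t) p)
    ... | ls , refl = ∈P.∈-map⁺ _ (∈-allVecs ls)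

-- One elimination step. A nonzero coefficient is negated by no sign generator, so D(t) is
-- admissible and a multiple of its enumerator can clear the monomial of `t` from `p`.
module Subtract {m} {p : Poly m} (S : Symmetric p) {N} (t : Vec (Vec Bool N) m) (nz : coeff p (cweMonomial t) ≢ 0ℚ) where

  private
    D = spanCode t

    signs-fix : ∀ c a → signChar c a (cweMonomial t) ≡ false
    signs-fix c a with signChar c a (cweMonomial t) in eq
    ... | false = refl
    ... | true  = contradiction (sign-vanish S c a _ eq) nz

    D-admissible : Admissible m D
    D-admissible = signs-fix⇒admissible t signs-fix

    D-ones : ContainsOnes D
    D-ones = proj₁ (proj₂ D-admissible)

    -- The number of tuples over `D` with the monomial of `t`. It is positive but can exceed 1,
    -- since a coordinate permutation preserving `D` may move `t`; hence the division in `k`.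
    n = coeff (cwe m D) (cweMonomial t)

    instance
      n-nonZero : ℚ.NonZero n
      n-nonZero = ℚ.≢-nonZero (cwe-positive D {t} (lookup-∈-spanCode t) (λ _ → refl))

    k = coeff p (cweMonomial t) ℚ.* (ℚ.1/ n)

  remainder : Poly m
  remainder = p ++ scale (ℚ.- k) (cwe m D)

  private
    coeff-remainder : ∀ e → coeff remainder e ≡ coeff p e ℚ.+ ℚ.- k ℚ.* coeff (cwe m D) e
    coeff-remainder e = trans (coeff-++ p _ e) (cong (coeff p e ℚ.+_) (coeff-scale (ℚ.- k) (cwe m D) e))

  remainder-symmetric : Symmetric remainder
  remainder-symmetric = symmetric-++ S (symmetric-scale (ℚ.- k) (cwe-symmetric D (proj₁ D-admissible) D-ones))

  remainder-vanishes : coeff remainder (cweMonomial t) ≡ 0ℚ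
  remainder-vanishes = begin
    coeff remainder (cweMonomial t)   ≡⟨ coeff-remainder _ ⟩
    c ℚ.+ ℚ.- k ℚ.* n                 ≡⟨ cong (c ℚ.+_) (sym (ℚP.neg-distribˡ-* k n)) ⟩
    c ℚ.+ ℚ.- (k ℚ.* n)               ≡⟨ cong (λ x → c ℚ.+ ℚ.- x) (trans (ℚP.*-assoc c _ n) (trans (cong (c ℚ.*_) (ℚP.*-inverseˡ n)) (ℚP.*-identityʳ c))) ⟩
    c ℚ.+ ℚ.- c                       ≡⟨ ℚP.+-inverseʳ c ⟩
    0ℚ                                ∎
    where c = coeff p (cweMonomial t)

  remainder-isLinComb⇒ : IsLinComb remainder → IsLinComb p
  remainder-isLinComb⇒ (L , h) = (k , N , D , D-admissible) ∷ L , λ e → let x = k ℚ.* coeff (cwe m D) e in sym (begin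
    coeff (linComb m ((k , N , D , D-admissible) ∷ L)) e ≡⟨ coeff-linComb-∷ k (N , D , D-admissible) L e ⟩
    x ℚ.+ coeff (linComb m L) e        ≡⟨ cong (x ℚ.+_) (trans (sym (h e)) (coeff-remainder e)) ⟩
    x ℚ.+ (coeff p e ℚ.+ ℚ.- k ℚ.* coeff (cwe m D) e) ≡⟨ cong (λ y → x ℚ.+ (coeff p e ℚ.+ y)) (sym (ℚP.neg-distribˡ-* k _)) ⟩
    x ℚ.+ (coeff p e ℚ.+ ℚ.- x)        ≡⟨ ℚP.+-comm x _ ⟩
    (coeff p e ℚ.+ ℚ.- x) ℚ.+ x        ≡⟨ ℚP.+-assoc (coeff p e) (ℚ.- x) x ⟩
    coeff p e ℚ.+ (ℚ.- x ℚ.+ x)        ≡⟨ cong (coeff p e ℚ.+_) (ℚP.+-inverseˡ x) ⟩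
    coeff p e ℚ.+ 0ℚ                   ≡⟨ ℚP.+-identityʳ _ ⟩
    coeff p e                          ∎)

  -- The monomials of cwe (D(m)) other than the orbit of t span smaller codes.
  remainder-support : ∀ {N'} (u : Vec (Vec Bool N') m) → coeff remainder (cweMonomial u) ≢ 0ℚ →
    coeff p (cweMonomial u) ≢ 0ℚ ⊎ size u < size t
  remainder-support u nz' with coeff (cwe m D) (cweMonomial u) ℚP.≟ 0ℚ
  ... | yes z = inj₁ λ z' → nz' (trans (coeff-remainder _) (trans (cong₂ (λ x y → x ℚ.+ ℚ.- k ℚ.* y) z' z)
    (trans (ℚP.+-identityˡ _) (ℚP.*-zeroʳ (ℚ.- k)))))
  ... | no ¬z with cwe-term D (cweMonomial u) ¬z
  -- If `u` spans as many words as `t`, then `s`, which has the monomial of `u`, generates all of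
  -- `D` and so lies in the affine orbit of `t`, where the remainder vanishes.
  ... | s , s∈ , eq = inj₂ (ℕP.≤∧≢⇒< M.size≤ (λ same → nz' (begin
      coeff remainder (cweMonomial u) ≡⟨ coeff-cong remainder (≐-sym eq) ⟩
      coeff remainder (cweMonomial s) ≡⟨ related⇒same-coeff remainder-symmetric
        (generators-related D D-ones (M.generates (ℕP.≤-reflexive (sym same))) (spanCode-generated t)) ⟩
      coeff remainder (cweMonomial t) ≡⟨ remainder-vanishes ⟩
      0ℚ ∎)))
    where module M = SharedMonomial (spanCode-generated u) {C' = D} D-ones {s} s∈ (≐-sym eq)

-- E lists the monomials of p that may still span a code with d elements.
symmetric⇒isLinComb : ∀ {m} d (E : List (Monomial m)) {p : Poly m} → Symmetric p →
  (∀ {N} (t : Vec (Vec Bool N) m) → coeff p (cweMonomial t) ≢ 0ℚ → size t ≤ d) →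
  (∀ {N} (t : Vec (Vec Bool N) m) → coeff p (cweMonomial t) ≢ 0ℚ → size t ≡ d → Any (_≐ cweMonomial t) E) →
  IsLinComb p
symmetric⇒isLinComb zero [] {p} S bound top = coeff-zero⇒isLinComb {p = p} λ t → vanish t
  where
    vanish : ∀ {N} (t : Vec (Vec Bool N) _) → coeff p (cweMonomial t) ≡ 0ℚ
    vanish t with coeff p (cweMonomial t) ℚP.≟ 0ℚ
    ... | yes z = z
    ... | no nz with () ← top t nz (ℕP.n≤0⇒n≡0 (bound t nz))
-- The top size is exhausted: restart one size lower with all terms of the current `p` as
-- candidates. Termination is lexicographic in `d` and `E`.
symmetric⇒isLinComb (suc d) [] {p} S bound top = symmetric⇒isLinComb d (L.map proj₂ p) S
  (λ t nz → s≤s⁻¹ (ℕP.≤∧≢⇒< (bound t nz) (λ eq → ¬Any[] (top t nz eq))))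
  (λ t nz _ → AnyP.map⁺ (coeff≢0⇒term p (cweMonomial t) nz))
  where
    ¬Any[] : ∀ {e : Monomial _} → ¬ Any (_≐ e) []
    ¬Any[] ()
symmetric⇒isLinComb {m} d (e ∷ E) {p} S bound top with monomial-realised e
... | N , t , eq with coeff p (cweMonomial t) ℚP.≟ 0ℚ
... | yes z = symmetric⇒isLinComb d E S bound λ u nz same → drop u nz (top u nz same)
  where
    drop : ∀ {N'} (u : Vec (Vec Bool N') m) → coeff p (cweMonomial u) ≢ 0ℚ → Any (_≐ cweMonomial u) (e ∷ E) → Any (_≐ cweMonomial u) E
    drop u nz (here e≐)  = contradiction (trans (coeff-cong p (≐-sym (≐-trans eq e≐))) z) nz
    drop u nz (there u∈) = u∈
-- `t` may span fewer than `d` words. Subtraction is still safe: monomials it introduces span fewer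
-- words than `t`, so they never enter the layer of size `d`.
... | no nz = remainder-isLinComb⇒ (symmetric⇒isLinComb d E remainder-symmetric bound' top')
  where
    open Subtract S t nz
    bound' : ∀ {N'} (u : Vec (Vec Bool N') m) → coeff remainder (cweMonomial u) ≢ 0ℚ → size u ≤ d
    bound' u nz' with remainder-support u nz'
    ... | inj₁ old     = bound u old
    ... | inj₂ smaller = ℕP.≤-trans (ℕP.<⇒≤ smaller) (bound t nz)
    top' : ∀ {N'} (u : Vec (Vec Bool N') m) → coeff remainder (cweMonomial u) ≢ 0ℚ → size u ≡ d → Any (_≐ cweMonomial u) E
    top' u nz' same with remainder-support u nz'
    ... | inj₂ smaller = contradiction smaller (ℕP.≤⇒≯ (subst (size t ≤_) (sym same) (bound t nz)))
    ... | inj₁ old with top u old same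
    ...   | here e≐  = contradiction (trans (coeff-cong remainder (≐-sym (≐-trans eq e≐))) remainder-vanishes) nz'
    ...   | there u∈ = u∈

-- Linear independence

equivalent-sym : ∀ {N N'} {C : LinearCode N} {C' : LinearCode N'} → Equivalent C C' → Equivalent C' C
equivalent-sym {C = C} {C'} (σ , h) = Perm.flip σ , λ y →
  trans (sym (h (permuteV (Perm.flip σ) y))) (cong (mem C') (permuteV-flip (Perm.flip σ) y))

x*n≡0⇒x≡0 : ∀ x n .{{_ : ℚ.NonZero n}} → x ℚ.* n ≡ 0ℚ → x ≡ 0ℚ
x*n≡0⇒x≡0 x n h = begin
  x                        ≡⟨ sym (ℚP.*-identityʳ x) ⟩
  x ℚ.* 1ℚ                 ≡⟨ cong (x ℚ.*_) (sym (ℚP.*-inverseʳ n)) ⟩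
  x ℚ.* (n ℚ.* ℚ.1/ n)     ≡⟨ sym (ℚP.*-assoc x n _) ⟩
  x ℚ.* n ℚ.* ℚ.1/ n       ≡⟨ cong (ℚ._* ℚ.1/ n) h ⟩
  0ℚ ℚ.* ℚ.1/ n            ≡⟨ ℚP.*-zeroˡ (ℚ.1/ n) ⟩
  0ℚ                       ∎

module _ {m : ℕ} (e : Monomial m) where

  contribution : ℚ × AdmCode m → ℚ
  contribution (k , A) = k ℚ.* coeff (cwe m (codeOf A)) e

  linComb-vanish : ∀ {L} → (∀ {x} → x ∈ L → contribution x ≡ 0ℚ) → coeff (linComb m L) e ≡ 0ℚ
  linComb-vanish {[]}          h = refl
  linComb-vanish {(k , A) ∷ L} h = trans (coeff-linComb-∷ k A L e)
    (cong₂ ℚ._+_ (h (here refl)) (linComb-vanish (h ∘ there)))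

  linComb-isolate : ∀ {L x} → AllPairs (λ a b → ¬ EquivAdm (proj₂ a) (proj₂ b)) L → x ∈ L →
    (∀ {y} → y ∈ L → ¬ EquivAdm (proj₂ x) (proj₂ y) → contribution y ≡ 0ℚ) → coeff (linComb m L) e ≡ contribution x
  linComb-isolate {(k , A) ∷ L} (new ∷ _) (here refl) h = trans (coeff-linComb-∷ k A L e)
    (trans (cong (contribution (k , A) ℚ.+_) (linComb-vanish (λ y∈ → h (there y∈) (All.lookup new y∈)))) (ℚP.+-identityʳ _))
  linComb-isolate {(k , A) ∷ L} {x} (new ∷ distinct) (there x∈) h = trans (coeff-linComb-∷ k A L e)
    (trans (cong₂ ℚ._+_ (h (here refl) (λ eq → All.lookup new x∈ (equivalent-sym {C = codeOf (proj₂ x)} {codeOf A} eq)))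
      (linComb-isolate distinct x∈ (h ∘ there))) (ℚP.+-identityˡ _))

bounded : ∀ {A : Set} (f : A → ℕ) xs → Σ ℕ λ M → ∀ {x} → x ∈ xs → f x ≤ M
bounded f []       = 0 , λ ()
bounded f (x ∷ xs) with bounded f xs
... | M , h = f x ⊔ M , λ { (here refl) → ℕP.m≤m⊔n (f x) M ; (there p) → ℕP.≤-trans (h p) (ℕP.m≤n⊔m (f x) M) }

module _ {m : ℕ} {L : List (ℚ × AdmCode m)} (distinct : AllPairs (λ a b → ¬ EquivAdm (proj₂ a) (proj₂ b)) L)
         (zero-sum : linComb m L ≈P []) where

  private
    codeSize : ℚ × AdmCode m → ℕ
    codeSize x = ∣ codeOf (proj₂ x) ∣C

    M = proj₁ (bounded codeSize L)

    -- The relation is tested at the monomial of a tuple generating C. Another code of the list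
    -- contains this monomial only if a permutation carries C into it. If it is larger, its
    -- coefficient is already zero; otherwise it would be equivalent to C.
    step : ∀ {x} → x ∈ L → (∀ {y} → y ∈ L → codeSize x < codeSize y → proj₁ y ≡ 0ℚ) → proj₁ x ≡ 0ℚ
    step {x@(k , N , C , orth , ones , dim)} x∈ larger with dimAtMost⇒generated C ones dim
    ... | t , G = x*n≡0⇒x≡0 k n (trans (sym (linComb-isolate (cweMonomial t) distinct x∈ other)) (zero-sum (cweMonomial t)))
      where
        n = coeff (cwe m C) (cweMonomial t)
        instance
          n-nonZero : ℚ.NonZero n
          n-nonZero = ℚ.≢-nonZero (cwe-positive C {t} (⊆C G) (λ _ → refl))
        other : ∀ {y} → y ∈ L → ¬ EquivAdm (proj₂ x) (proj₂ y) → contribution (cweMonomial t) y ≡ 0ℚ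
        other {k' , N' , C' , _ , ones' , _} y∈ ¬eq with coeff (cwe m C') (cweMonomial t) ℚP.≟ 0ℚ
        ... | yes z = trans (cong (k' ℚ.*_) z) (ℚP.*-zeroʳ k')
        ... | no nz with cwe-term C' (cweMonomial t) nz
        ...   | u , u∈ , eq = trans (cong (ℚ._* coeff (cwe m C') (cweMonomial t))
                  (larger y∈ (ℕP.≰⇒> (¬eq ∘ SharedMonomial.equivalent G {C' = C'} ones' {u} u∈ (≐-sym eq))))) (ℚP.*-zeroˡ (coeff (cwe m C') (cweMonomial t)))

    -- Induction from the largest codes down.
    descend : ∀ d {x} → x ∈ L → M < codeSize x + d → proj₁ x ≡ 0ℚ
    descend zero    {x} x∈ lt = contradiction (subst (M <_) (ℕP.+-identityʳ (codeSize x)) lt) (ℕP.≤⇒≯ (proj₂ (bounded codeSize L) x∈))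
    descend (suc d) {x} x∈ lt = step x∈ λ {y} y∈ x<y → descend d y∈
      (ℕP.<-≤-trans lt (subst (_≤ codeSize y + d) (sym (ℕP.+-suc (codeSize x) d)) (ℕP.+-monoˡ-≤ d x<y)))

  independent : All (λ a → proj₁ a ≡ 0ℚ) L
  independent = All.tabulate λ {x} x∈ → descend (suc M) x∈ (ℕP.m≤n+m (suc M) (codeSize x))

theorem4p6 : (m : ℕ) → 1 ≤ m →
    ((A : AdmCode m) → Invariant m (cwe m (codeOf A)))
    × ((p : Poly m) → Invariant m p →
    Σ (List (ℚ × AdmCode m)) λ L → p ≈P linComb m L)
    × ((L : List (ℚ × AdmCode m)) →
    AllPairs (λ a b → ¬ EquivAdm (proj₂ a) (proj₂ b)) L →
    linComb m L ≈P [] →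
    All (λ a → proj₁ a ≡ 0ℚ) L)
theorem4p6 m _ =
    (λ (N , C , orth , ones , dim) → symmetric⇒invariant (cwe-symmetric C orth ones))
  -- Starting data: no D(t) has more than 2^(m+1) words, and every monomial with nonzero coefficient
  -- is among the terms of `p`.
  , (λ p inv → symmetric⇒isLinComb (length (allVecs (suc m))) (L.map proj₂ p) (invariant⇒symmetric inv)
      (λ t _ → codewords≤ t) (λ t nz _ → AnyP.map⁺ (coeff≢0⇒term p (cweMonomial t) nz)))
  , λ L distinct zero-sum → independent distinct zero-sum
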